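{- Let $(\mathbf{d}^+,\mathbf{d}^-)$ be a directed degree sequence with realizations $\vec G_1$ and $\vec G_2$ (on the same labeled vertex set). Then $$\mathbf{dist}_d(\vec G_1,\vec G_2)=H'(\vec G_1,\vec G_2)-\mathbf{maxC}_d(\vec G_1,\vec G_2).$$
   Context: Directed graphs are finite, without loops and without parallel edges (both $xy$ and $yx$ may be present), with labeled vertices $x_1,\dots,x_n$. The directed degree sequence of $\vec G$ is the pair $\big((d_1^+,\dots,d_n^+),(d_1^-,\dots,d_n^-)\big)$ of out-degrees and in-degrees of the vertices; $\vec G$ is then called a realization of this pair. Bipartite representation: $B(\vec G)$ has classes $U=\{u_x\}$ and $W=\{w_x\}$, one copy of each vertex $x$ in each class, and the directed edge $xy$ is represented by the edge $u_xw_y$. The pairs $u_xw_x$ are non-chords (they can never be edges); all other pairs $u_xw_y$ ($x\ne y$) are chords. Swaps: (1) A $C_4$-swap: for distinct $u_x,u_z\in U$ and distinct $w_y,w_t\in W$ such that all four pairs between them are chords, with $u_xw_y,u_zw_t$ edges and $u_xw_t,u_zw_y$ not edges, replace the edges $u_xw_y,u_zw_t$ by $u_xw_t,u_zw_y$ (i.e. replace directed edges $xy,zt$ by $xt,zy$). (2) A triangular $C_6$-swap: for three distinct vertices $x,y,z$ such that $xy,yz,zx$ are directed edges and $yx,zy,xz$ are not, replace $xy,yz,zx$ by $yx,zy,xz$ (reversing an oriented triangle; in the bipartite representation this exchanges the edges and non-edges along a 6-cycle in which the three opposite pairs are non-chords). Only these two types of swaps are allowed. A $C_4$-swap has weight $1$,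 a triangular $C_6$-swap has weight $2$. $\mathbf{dist}_d(\vec G_1,\vec G_2)$ is the minimum total weight of a swap sequence transforming $\vec G_1$ into $\vec G_2$. $H'(\vec G_1,\vec G_2)=|E(\vec G_1)\,\Delta\, E(\vec G_2)|/2$, where $\Delta$ is the symmetric difference of the sets of directed edges. The red-blue directed graph associated with $\vec G_1,\vec G_2$ has the common vertex set, directed edge set $E(\vec G_1)\,\Delta\, E(\vec G_2)$, edges of $E(\vec G_1)\setminus E(\vec G_2)$ red and edges of $E(\vec G_2)\setminus E(\vec G_1)$ blue. It is balanced: at each vertex the red in-degree equals the blue in-degree and the red out-degree equals the blue out-degree. An alternating circuit in it is a closed trail (orientations ignored when traversing, each directed edge used at most once) along which, cyclically, both the colors and the directions alternate: consecutive edges have different colors and are either both directed into or both directed out of their common vertex in the trail (e.g. if $v_iv_{i+1}$ is a red directed edge, then $v_{i+2}v_{i+1}$ is a blue directed edge). Equivalently, it corresponds to a color-alternating closed trail in the bipartite representation. Every balanced red-blue directed graph can be decomposed into alternating circuits, and $\mathbf{maxC}_d(\vec G_1,\vec G_2)$ is the maximum number of circuits in a decomposition of the edge set of the associated red-blue directed graph into alternating circuits. -}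

module Defs where

open import Data.Bool.Base using (Bool; true; false)
import Data.Bool.Properties as Bool
open import Data.Empty using (⊥)
open import Data.Fin.Base using (Fin)
open import Data.Fin.Subset using (∣_∣)
open import Data.Integer.Base using (+_)
open import Data.List.Base
  using (List; []; _∷_; _∷ʳ_; length; map; concatMap; filter; allFin; cartesianProduct)
open import Data.List.Membership.Propositional using (_∈_; _∉_)
open import Data.List.Relation.Binary.Permutation.Propositional using (_↭_)
open import Data.List.Relation.Unary.All using (All)
open import Data.List.Relation.Unary.Linked using (Linked)
open import Data.List.Relation.Unary.Unique.Propositional using (Unique)
open import Data.Nat.Base using (ℕ; _+_; _≤_)
open import Data.Product.Base using (_×_; _,_; ∃-syntax)
open import Data.Rational.Base using (ℚ; _/_)
open import Data.Sum.Base using (_⊎_)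
open import Data.Vec.Base using (tabulate)
open import Data.Vec.Functional using (Vector)
open import Function.Bundles using (_⇔_)
open import Relation.Binary.PropositionalEquality.Core using (_≡_; _≢_)
open import Relation.Nullary.Negation.Core using (¬_)
open import Relation.Nullary.Decidable.Core using (¬?)

Arc : ℕ → Set
Arc n = Fin n × Fin n

record Digraph (n : ℕ) : Set where
  field
    adj      : Fin n → Fin n → Bool
    loopless : ∀ x → adj x x ≡ false

open Digraph public

module _ {n : ℕ} where

  infix 4 _∈E_ _∉E_ _≈_

  _∈E_ _∉E_ : Arc n → Digraph n → Set
  (x , y) ∈E G = adj G x y ≡ true
  e ∉E G = ¬ (e ∈E G)

  -- Equality of labelled digraphs; propositional equality of the records
  -- would need function extensionality.
  _≈_ : Digraph n → Digraph n → Set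
  G ≈ H = ∀ x y → adj G x y ≡ adj H x y

  outDegree inDegree : Digraph n → Fin n → ℕ
  outDegree G x = ∣ tabulate (λ y → adj G x y) ∣
  inDegree  G x = ∣ tabulate (λ y → adj G y x) ∣

  IsRealization : Vector ℕ n → Vector ℕ n → Digraph n → Set
  IsRealization d⁺ d⁻ G = ∀ x → outDegree G x ≡ d⁺ x × inDegree G x ≡ d⁻ x

  -- The pair u_x w_y of the bipartite representation is a chord; the arc xy
  -- corresponds to its edge u_x w_y.
  Chord : Arc n → Set
  Chord (x , y) = x ≢ y

  record Replace (old new : List (Arc n)) (G G′ : Digraph n) : Set where
    field
      old-present : All (_∈E G) old
      new-absent  : All (_∉E G) new
      result      : ∀ e → e ∈E G′ ⇔ (e ∈ new ⊎ (e ∈E G × e ∉ old))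

  -- Swap G G′ w: one swap of weight w turns G into G′.
  data Swap (G G′ : Digraph n) : ℕ → Set where
    C₄ : ∀ {x y z t} → x ≢ z → y ≢ t →
         All Chord ((x , y) ∷ (z , t) ∷ (x , t) ∷ (z , y) ∷ []) →
         Replace ((x , y) ∷ (z , t) ∷ []) ((x , t) ∷ (z , y) ∷ []) G G′ →
         Swap G G′ 1
    triangular-C₆ : ∀ {x y z} → x ≢ y → y ≢ z → z ≢ x →
         Replace ((x , y) ∷ (y , z) ∷ (z , x) ∷ [])
                 ((y , x) ∷ (z , y) ∷ (x , z) ∷ []) G G′ →
         Swap G G′ 2

  -- The index is the total weight.
  data SwapSequence (G K : Digraph n) : ℕ → Set where
    done : G ≈ K → SwapSequence G K 0
    step : ∀ {H v w} → Swap G H v → SwapSequence H K w → SwapSequence G K (v + w)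

  -- E(G₁) Δ E(G₂), each arc listed exactly once.
  symmetricDifference : Digraph n → Digraph n → List (Arc n)
  symmetricDifference G₁ G₂ =
    filter (λ (x , y) → ¬? (adj G₁ x y Bool.≟ adj G₂ x y))
           (cartesianProduct (allFin n) (allFin n))

  H′ : Digraph n → Digraph n → ℚ
  H′ G₁ G₂ = + length (symmetricDifference G₁ G₂) / 2

  -- A step of a trail goes from the left vertex to the right one, along an
  -- arc pointing forwards (⟶) or backwards (⟵).
  data Step : Set where
    _⟶_ _⟵_ : Fin n → Fin n → Step

  arcOf : Step → Arc n
  arcOf (x ⟶ y) = x , y
  arcOf (x ⟵ y) = y , x

  module RedBlue (G₁ G₂ : Digraph n) where

    Red Blue : Arc n → Set
    Red  e = e ∈E G₁ × e ∉E G₂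
    Blue e = e ∈E G₂ × e ∉E G₁

    DifferentColours : Arc n → Arc n → Set
    DifferentColours e f = (Red e × Blue f) ⊎ (Blue e × Red f)

    data Alternates : Step → Step → Set where
      both-in  : ∀ {x y z} → DifferentColours (x , y) (z , y) →
                 Alternates (x ⟶ y) (y ⟵ z)
      both-out : ∀ {x y z} → DifferentColours (y , x) (y , z) →
                 Alternates (x ⟵ y) (y ⟶ z)

    -- Repeating the first step at the end makes the condition cyclic, so the
    -- trail is closed and alternates at its starting vertex too.
    IsAlternatingCircuit : List Step → Set
    IsAlternatingCircuit []       = ⊥
    IsAlternatingCircuit (s ∷ ss) =
      Linked Alternates ((s ∷ ss) ∷ʳ s) × Unique (map arcOf (s ∷ ss))

    -- As the symmetric difference is listed without repetition, the
    -- permutation says that every arc lies in exactly one of the circuits.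
    IsDecomposition : List (List Step) → Set
    IsDecomposition cs =
      All IsAlternatingCircuit cs ×
      concatMap (map arcOf) cs ↭ symmetricDifference G₁ G₂

  open RedBlue public using (IsDecomposition)

IsMinimum IsMaximum : (ℕ → Set) → ℕ → Set
IsMinimum P k = P k × (∀ j → P j → k ≤ j)
IsMaximum P k = P k × (∀ j → P j → j ≤ k)

-- dist_d and maxC_d are given by their graphs: these relations determine the
-- last argument uniquely.
IsDist : ∀ {n} → Digraph n → Digraph n → ℕ → Set
IsDist G₁ G₂ = IsMinimum (SwapSequence G₁ G₂)

IsMaxC : ∀ {n} → Digraph n → Digraph n → ℕ → Set
IsMaxC G₁ G₂ =
  IsMaximum (λ k → ∃[ cs ] (IsDecomposition G₁ G₂ cs × length cs ≡ k))

{-# OPTIONS --safe #-}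
module Submission where

-- Read a red arc xy as a dart u_x → w_y and a blue one as a dart w_y → u_x.  Alternating circuits
-- become closed directed walks, which exist because equal degrees make the darts balanced, and an arc
-- used in both colours becomes a pair of opposite darts.  Cancelling such a pair loses at most one
-- circuit, while a swap of weight v is a closed walk of 2v + 2 darts.  Hence concatenating the walks
-- of a swap sequence of weight m and cancelling leaves a decomposition of E(G₁) Δ E(G₂) into at least
-- H′ − m circuits.
--
-- Conversely, let s₀ s₁ s₂ be consecutive darts of a circuit C and d the dart closing them up.  If d
-- is a chord, then a C₄-swap in G₁ or in G₂ replaces s₀ s₁ s₂ by d, unless d itself lies in the
-- symmetric difference; in that case exchanging d for s₀ s₁ s₂ splits C, or shortens it at the expense
-- of another circuit.  If no three consecutive darts of C are closed up by a chord, C is an oriented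
-- triangle and a C₆-swap removes it.  So H′ − (number of circuits) can always be spent on swaps.

open import Defs
open import Data.Bool.Base using (Bool; true; false; if_then_else_; _∧_; _∨_; not)
open import Data.Bool.Properties using (⇔→≡; ∧-identityʳ; ∧-zeroʳ; ¬-not) renaming (_≟_ to _≟ᴮ_)
open import Data.Empty using (⊥-elim)
open import Data.Fin.Base using (Fin)
import Data.Fin.Properties as Fin
open import Data.Fin.Subset using (∣_∣)
open import Data.Integer.Base using (ℤ; +_; 0ℤ; 1ℤ)
  renaming (_+_ to _+ℤ_; _-_ to _-ℤ_; -_ to -ℤ_; _*_ to _*ℤ_)
import Data.Integer.Properties as ℤ
open import Data.Integer.Tactic.RingSolver using (solve-∀)
open import Data.List.Base
  using (List; []; _∷_; _++_; _∷ʳ_; length; map; concatMap; filter; reverse; cartesianProduct; allFin; tabulate)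
import Data.List.Properties as List
open import Data.List.Membership.Propositional using (_∈_; _∉_; find)
open import Data.List.Membership.Propositional.Properties
  using (∈-∃++; ∈-++⁻; ∈-++⁺ˡ; ∈-map⁺; ∈-map⁻; ∈-filter⁺; ∈-filter⁻; ∈-cartesianProduct⁺; ∈-allFin)
open import Data.List.Membership.Propositional.Properties.WithK using (unique∧set⇒bag)
open import Data.List.Relation.Binary.BagAndSetEquality using (∼bag⇒↭)
open import Data.List.Relation.Binary.Permutation.Propositional as Perm
  using (_↭_; ↭-refl; ↭-reflexive; ↭-sym; ↭-trans; ↭-prep; ↭-swap; ↭⇒↭ₛ)
open import Data.List.Relation.Binary.Permutation.Propositional.Properties
  using (∈-resp-↭; All-resp-↭; ↭-empty-inv; ↭-length; ++⁺ˡ; ++⁺ʳ; ++-comm; ++-assoc; shift; shifts;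
         ↭-reverse; ∷↭∷ʳ; map⁺)
open import Data.List.Relation.Binary.Permutation.Setoid.Properties using (Unique-resp-↭)
open import Data.List.Relation.Unary.All as All using (All; []; _∷_)
import Data.List.Relation.Unary.All.Properties as All
open import Data.List.Relation.Unary.AllPairs using ([]; _∷_)
open import Data.List.Relation.Unary.Any as Any using (here; there)
open import Data.List.Relation.Unary.Linked using (Linked; [-]; _∷_)
open import Data.List.Relation.Unary.Unique.Propositional using (Unique)
open import Data.List.Relation.Unary.Unique.Propositional.Properties
  using (filter⁺; cartesianProduct⁺; allFin⁺; map⁻)
open import Data.Nat.Base using (ℕ; zero; suc; _+_; _*_; _≤_; _<_; z≤n; s≤s)
open import Data.Nat.ListAction using (sum)
open import Data.Nat.ListAction.Properties using (sum-++; sum-↭)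
import Data.Nat.Properties as ℕ
import Data.Nat.Tactic.RingSolver as ℕ-Ring
open import Data.Product.Base using (_×_; _,_; ∃-syntax; Σ-syntax; proj₁; proj₂)
open import Data.Product.Properties using (≡-dec)
open import Data.Rational.Base using (_/_; _-_; toℚᵘ) renaming (_+_ to _+ℚ_)
import Data.Rational.Properties as ℚ
import Data.Rational.Unnormalised.Base as ℚᵘ
import Data.Rational.Unnormalised.Properties as ℚᵘ
open import Data.Sum.Base using (_⊎_; inj₁; inj₂; [_,_]′)
import Data.Vec.Base as Vec
open import Data.Vec.Functional using (Vector)
open import Function.Base using (_∘_; id)
open import Function.Bundles using (_⇔_; mk⇔; Equivalence)
open import Function.Construct.Composition using (_⇔-∘_)
open import Function.Construct.Symmetry using (⇔-sym)
open import Relation.Binary.Definitions using (DecidableEquality)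
open import Relation.Binary.PropositionalEquality
  using (_≡_; _≢_; refl; sym; trans; cong; cong₂; subst; setoid; module ≡-Reasoning)
open import Relation.Nullary.Decidable using (Dec; yes; no; does; map′; ¬?; _×-dec_; _⊎-dec_)
open import Relation.Nullary.Negation using (¬_; contradiction)

private variable
  A B : Set
  n k m i j ℓ : ℕ

-- Walks

data Node (n : ℕ) : Set where
  u w : Fin n → Node n

-- Traversing red arcs from U to W and blue arcs from W to U turns alternating
-- circuits into closed directed walks: pos e is the arc e used in red, neg e
-- the arc e used in blue.
data Dart (n : ℕ) : Set where
  pos neg : Arc n → Dart n

arc : Dart n → Arc n
arc (pos e) = e
arc (neg e) = e

rev : Dart n → Dart n
rev (pos e) = neg e
rev (neg e) = pos e

tail head : Dart n → Node n
tail (pos (x , y)) = u x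
tail (neg (x , y)) = w y
head (pos (x , y)) = w y
head (neg (x , y)) = u x

head≢tail : (s : Dart n) → head s ≢ tail s
head≢tail (pos _) ()
head≢tail (neg _) ()

head-rev : (s : Dart n) → head (rev s) ≡ tail s
head-rev (pos _) = refl
head-rev (neg _) = refl

tail-rev : (s : Dart n) → tail (rev s) ≡ head s
tail-rev (pos _) = refl
tail-rev (neg _) = refl

rev-involutive : (s : Dart n) → rev (rev s) ≡ s
rev-involutive (pos _) = refl
rev-involutive (neg _) = refl

private variable
  a b b′ v : Node n
  s t s₀ s₁ s₂ d : Dart n
  p q c es fs : List (Dart n)

infixr 5 _∷_

data Walk {n} : Node n → List (Dart n) → Node n → Set where
  []  : Walk a [] a
  _∷_ : a ≡ tail s → Walk (head s) es b → Walk a (s ∷ es) b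

-- Closed walks with at least one dart, listed from a chosen starting point; darts may repeat.
data Circuit {n} : List (Dart n) → Set where
  close : Walk (head s) es (tail s) → Circuit (s ∷ es)

walk-++⁺ : Walk a es b → Walk b fs b′ → Walk a (es ++ fs) b′
walk-++⁺ []      q = q
walk-++⁺ (e ∷ p) q = e ∷ walk-++⁺ p q

walk-++⁻ : ∀ (es : List (Dart n)) → Walk a (es ++ fs) b′ → ∃[ b ] (Walk a es b × Walk b fs b′)
walk-++⁻ []       p       = _ , [] , p
walk-++⁻ (_ ∷ es) (e ∷ p) with b , q , r ← walk-++⁻ es p = b , e ∷ q , r

walk-reverse : Walk a es b → Walk b (reverse (map rev es)) a
walk-reverse [] = []
walk-reverse {es = s ∷ es} (refl ∷ p) =
  subst (λ fs → Walk _ fs _) (sym (List.unfold-reverse (rev s) (map rev es)))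
    (walk-++⁺ (walk-reverse p)
      (sym (tail-rev s) ∷ subst (λ v → Walk v [] (tail s)) (sym (head-rev s)) []))

close′ : a ≡ tail s → b ≡ head s → Walk b es a → Circuit (s ∷ es)
close′ refl refl p = close p

closed⇒circuit : es ≢ [] → Walk a es a → Circuit es
closed⇒circuit ne []         = ⊥-elim (ne refl)
closed⇒circuit ne (refl ∷ p) = close p

circuit⇒closed : Circuit es → ∃[ a ] Walk a es a
circuit⇒closed (close p) = _ , refl ∷ p

circuit-reverse : Circuit es → Circuit (reverse (map rev es))
circuit-reverse {es = es} C@(close _) =
  closed⇒circuit ne (walk-reverse (proj₂ (circuit⇒closed C)))
  where
  ne : reverse (map rev es) ≢ []
  ne eq with () ← trans (cong length (sym eq))
                   (trans (List.length-reverse (map rev es)) (List.length-map rev es))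

rotate : s ∈ es → Circuit es → ∃[ p ] (Circuit (s ∷ p) × es ↭ s ∷ p)
rotate {s = s} s∈ C with ys , zs , refl ← ∈-∃++ s∈
  with _ , W ← circuit⇒closed C
  with _ , Y , e ∷ Z ← walk-++⁻ ys W =
  zs ++ ys , closed⇒circuit (λ ()) (e ∷ walk-++⁺ Z Y) , ++-comm ys (s ∷ zs)

walk-[] : Walk a [] b → a ≡ b
walk-[] [] = refl

-- The permutation in `add` makes the order of the darts immaterial: a multiset is decomposed into
-- exactly `k` circuits.
data Decomp {n} : List (Dart n) → ℕ → Set where
  []  : Decomp [] 0
  add : Circuit p → Decomp es k → fs ↭ p ++ es → Decomp fs (suc k)

decomp-↭ : fs ↭ es → Decomp es k → Decomp fs k
decomp-↭ σ [] with refl ← ↭-empty-inv σ = []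
decomp-↭ σ (add C D τ) = add C D (↭-trans σ τ)

decomp-++ : ∀ {j} → Decomp es j → Decomp fs k → Decomp (es ++ fs) (j + k)
decomp-++ []          E = E
decomp-++ {fs = fs} (add {p = p} {es = es} C D σ) E =
  add C (decomp-++ D E) (↭-trans (++⁺ʳ fs σ) (++-assoc p es fs))

-- An empty closed walk adds no circuit, any other adds one.
addClosed : Walk a p a → Decomp es k → ∃[ j ] (k ≤ j × Decomp (p ++ es) j)
addClosed []         D = _ , ℕ.≤-refl , D
addClosed (refl ∷ W) D = _ , ℕ.n≤1+n _ , add (close W) D ↭-refl

focus : s ∈ es → Decomp es k →
  ∃[ p ] ∃[ fs ] ∃[ j ] (Circuit (s ∷ p) × Decomp fs j × es ↭ s ∷ p ++ fs × k ≡ suc j)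
focus {s = s} {es = es} s∈ (add {p = c} {es = fs} C D σ) with ∈-++⁻ c (∈-resp-↭ σ s∈)
... | inj₁ s∈c with p , C′ , τ ← rotate s∈c C =
  p , fs , _ , C′ , D , ↭-trans σ (++⁺ʳ fs τ) , refl
... | inj₂ s∈fs with p , gs , _ , C′ , D′ , τ , refl ← focus s∈fs D =
  p , c ++ gs , _ , C′ , add C D′ ↭-refl ,
  ↭-trans σ (↭-trans (++⁺ˡ c τ) (shifts c (s ∷ p))) , refl

-- Two opposite darts lie either in one circuit, which breaks into two possibly empty closed walks,
-- or in two circuits, whose remainders join into one. At most one circuit is lost.
cancel : s ∈ es → rev s ∈ es → Decomp es k →
  ∃[ fs ] ∃[ j ] (Decomp fs j × es ↭ s ∷ rev s ∷ fs × k ≤ suc j)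
cancel {s = s} {es = es} s∈ s̄∈ D
  with p , fs , _ , close P , D′ , σ , refl ← focus s∈ D
  with ∈-++⁻ (s ∷ p) (∈-resp-↭ σ s̄∈)
... | inj₁ (here eq) = ⊥-elim (rev≢ s eq)
  where
  rev≢ : ∀ (s : Dart _) → rev s ≢ s
  rev≢ (pos _) ()
  rev≢ (neg _) ()
... | inj₁ (there s̄∈p) with p₁ , p₂ , refl ← ∈-∃++ s̄∈p
  with m , P₁ , refl ∷ P₂ ← walk-++⁻ p₁ P
  with j₂ , le₂ , D₂ ← addClosed (subst (λ v → Walk v p₂ (tail s)) (head-rev s) P₂) D′
  with j₁ , le₁ , D₁ ← addClosed (subst (λ v → Walk (head s) p₁ v) (tail-rev s) P₁) D₂ =
  p₁ ++ p₂ ++ fs , j₁ , D₁ ,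
  ↭-trans σ (↭-prep s (↭-trans (++-assoc p₁ (rev s ∷ p₂) fs) (shift (rev s) p₁ (p₂ ++ fs)))) ,
  s≤s (ℕ.≤-trans le₂ le₁)
... | inj₂ s̄∈fs
  with q , gs , j , close Q , D″ , τ , refl ← focus s̄∈fs D′ =
  p ++ q ++ gs , suc j ,
  add (closed⇒circuit (ne P) (walk-++⁺ P Q′)) D″ (↭-sym (++-assoc p q gs)) ,
  ↭-trans σ (↭-prep s (↭-trans (++⁺ˡ p τ) (shift (rev s) p (q ++ gs)))) ,
  ℕ.≤-refl
  where
  Q′ : Walk (tail s) q (head s)
  Q′ = subst (λ v → Walk v q (head s)) (head-rev s) (subst (Walk (head (rev s)) q) (tail-rev s) Q)
  -- The two ends of a dart are on opposite sides, so `p` cannot be empty.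
  ne : ∀ {p} → Walk (head s) p (tail s) → p ++ q ≢ []
  ne {[]} P eq = head≢tail s (walk-[] P)
  ne {_ ∷ _} P ()

-- The length of a walk from a to b has the parity dictated by the sides of a and b.
Bipartite : Node n → Node n → ℕ → Set
Bipartite (u _) (u _) m = ∃[ h ] m ≡ h + h
Bipartite (u _) (w _) m = ∃[ h ] m ≡ suc (h + h)
Bipartite (w _) (u _) m = ∃[ h ] m ≡ suc (h + h)
Bipartite (w _) (w _) m = ∃[ h ] m ≡ h + h

walk-length : Walk a es b → Bipartite a b (length es)
walk-length {a = u _} [] = 0 , refl
walk-length {a = w _} [] = 0 , refl
walk-length {b = u _} (_∷_ {s = pos _} refl P) with h , eq ← walk-length P =
  suc h , cong suc (trans eq (sym (ℕ.+-suc h h)))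
walk-length {b = u _} (_∷_ {s = neg _} refl P) with h , eq ← walk-length P = h , cong suc eq
walk-length {b = w _} (_∷_ {s = pos _} refl P) with h , eq ← walk-length P = h , cong suc eq
walk-length {b = w _} (_∷_ {s = neg _} refl P) with h , eq ← walk-length P =
  suc h , cong suc (trans eq (sym (ℕ.+-suc h h)))

circuit-length : Circuit es → ∃[ h ] length es ≡ suc h + suc h
circuit-length (close {s = pos _} P) with h , eq ← walk-length P =
  h , cong suc (trans eq (sym (ℕ.+-suc h h)))
circuit-length (close {s = neg _} P) with h , eq ← walk-length P =
  h , cong suc (trans eq (sym (ℕ.+-suc h h)))

-- Every circuit alternates between U and W, so its number of darts is even and positive, hence at
-- least two.
decomp-length : Decomp es k → ∃[ h ] (length es ≡ 2 * h × k ≤ h)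
decomp-length [] = 0 , refl , z≤n
decomp-length (add {p = p} {es = es} C D σ)
  with h , eq , le ← decomp-length D | i , eq′ ← circuit-length C =
  suc i + h ,
  trans (↭-length σ) (trans (List.length-++ p) (trans (cong₂ _+_ eq′ eq)
    (trans (cong (λ z → suc i + z + 2 * h) (sym (ℕ.+-identityʳ (suc i))))
           (sym (ℕ.*-distribˡ-+ 2 (suc i) h))))) ,
  s≤s (ℕ.≤-trans le (ℕ.m≤n+m h i))

-- Flows

private variable
  G H K G′ K′ : Digraph n

infix 4 _≟ᴬ_ _≟ᴰ_

_≟ᴬ_ : DecidableEquality (Arc n)
_≟ᴬ_ = ≡-dec Fin._≟_ Fin._≟_

_≟ᴰ_ : DecidableEquality (Dart n)
pos e ≟ᴰ pos f = map′ (cong pos) (λ { refl → refl }) (e ≟ᴬ f)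
pos e ≟ᴰ neg f = no λ ()
neg e ≟ᴰ pos f = no λ ()
neg e ≟ᴰ neg f = map′ (cong neg) (λ { refl → refl }) (e ≟ᴬ f)

δ : Arc n → Arc n → ℤ
δ f e = if does (f ≟ᴬ e) then 1ℤ else 0ℤ

δ-refl : (e : Arc n) → δ e e ≡ 1ℤ
δ-refl e with e ≟ᴬ e
... | yes _ = refl
... | no e≢e = contradiction refl e≢e

δ-≢ : {e f : Arc n} → f ≢ e → δ f e ≡ 0ℤ
δ-≢ {e = e} {f} f≢e with f ≟ᴬ e
... | yes f≡e = contradiction f≡e f≢e
... | no _ = refl

val : Dart n → Arc n → ℤ
val (pos f) e = δ f e
val (neg f) e = -ℤ δ f e

val-rev : ∀ (s : Dart n) e → val (rev s) e ≡ -ℤ val s e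
val-rev (pos f) e = refl
val-rev (neg f) e = sym (ℤ.neg-involutive _)

-- Signed multiplicity of an arc, red uses minus blue uses. Unlike the multiset itself, it does not
-- change when opposite darts cancel.
net : List (Dart n) → Arc n → ℤ
net []       e = 0ℤ
net (s ∷ es) e = val s e +ℤ net es e

net-++ : ∀ es {fs} (e : Arc n) → net (es ++ fs) e ≡ net es e +ℤ net fs e
net-++ []       e = sym (ℤ.+-identityˡ _)
net-++ (s ∷ es) e = trans (cong (val s e +ℤ_) (net-++ es e)) (sym (ℤ.+-assoc (val s e) _ _))

net-↭ : es ↭ fs → ∀ e → net es e ≡ net fs e
net-↭ Perm.refl e = refl
net-↭ (Perm.prep s σ) e = cong (val s e +ℤ_) (net-↭ σ e)
net-↭ (Perm.swap {xs} {ys} s t σ) e =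
  trans (cong (λ z → val s e +ℤ (val t e +ℤ z)) (net-↭ σ e)) (lemma (val s e) (val t e) (net ys e))
  where
  lemma : ∀ a b c → a +ℤ (b +ℤ c) ≡ b +ℤ (a +ℤ c)
  lemma = solve-∀
net-↭ (Perm.trans σ τ) e = trans (net-↭ σ e) (net-↭ τ e)

χ : Digraph n → Arc n → ℤ
χ G (x , y) = if adj G x y then 1ℤ else 0ℤ

χ-∈ : ∀ G {e : Arc n} → e ∈E G → χ G e ≡ 1ℤ
χ-∈ G eq = cong (if_then 1ℤ else 0ℤ) eq

χ-∉ : ∀ G {e : Arc n} → e ∉E G → χ G e ≡ 0ℤ
χ-∉ G {x , y} ne with adj G x y
... | true  = contradiction refl ne
... | false = refl

χ-cong : ∀ G H {e : Arc n} → e ∈E G ⇔ e ∈E H → χ G e ≡ χ H e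
χ-cong G H iff = cong (if_then 1ℤ else 0ℤ) (⇔→≡ iff)

infix 4 _∈E?_

_∈E?_ : ∀ (e : Arc n) G → Dec (e ∈E G)
(x , y) ∈E? G with adj G x y
... | true  = yes refl
... | false = no λ ()

record Represents (es : List (Dart n)) (G K : Digraph n) : Set where
  constructor represent
  field
    net-≡ : ∀ e → net es e ≡ χ G e -ℤ χ K e

open Represents

represents-↭ : es ↭ fs → Represents es G K → Represents fs G K
represents-↭ σ r .net-≡ e = trans (sym (net-↭ σ e)) (r .net-≡ e)

-- The sum telescopes: the indicator of the intermediate digraph `H` cancels.
represents-++ : Represents es G H → Represents fs H K → Represents (es ++ fs) G K
represents-++ {es = es} {G = G} {H} {K = K} r q .net-≡ e =
  trans (net-++ es e) (trans (cong₂ _+ℤ_ (r .net-≡ e) (q .net-≡ e)) (lemma (χ G e) (χ H e) (χ K e)))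
  where
  lemma : ∀ a b c → (a -ℤ b) +ℤ (b -ℤ c) ≡ a -ℤ c
  lemma = solve-∀

net-pair : ∀ (s : Dart n) es e → net (s ∷ rev s ∷ es) e ≡ net es e
net-pair s es e =
  trans (cong (λ z → val s e +ℤ (z +ℤ net es e)) (val-rev s e)) (lemma (val s e) (net es e))
  where
  lemma : ∀ a b → a +ℤ (-ℤ a +ℤ b) ≡ b
  lemma = solve-∀

represents-cancel-pair : Represents (s ∷ rev s ∷ es) G K → Represents es G K
represents-cancel-pair {s = s} {es = es} r .net-≡ e = trans (sym (net-pair s es e)) (r .net-≡ e)

represents-insert-pair : Represents es G K → Represents (s ∷ rev s ∷ es) G K
represents-insert-pair {es = es} {s = s} r .net-≡ e = trans (net-pair s es e) (r .net-≡ e)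

represents-rev : ∀ es → Represents es G K → Represents (map rev es) K G
represents-rev {G = G} {K} es r .net-≡ e =
  trans (net-rev es) (trans (cong -ℤ_ (r .net-≡ e)) (lemma (χ G e) (χ K e)))
  where
  lemma : ∀ a b → -ℤ (a -ℤ b) ≡ b -ℤ a
  lemma = solve-∀
  net-rev : ∀ es → net (map rev es) e ≡ -ℤ net es e
  net-rev []       = refl
  net-rev (s ∷ es) = trans (cong₂ _+ℤ_ (val-rev s e) (net-rev es))
    (sym (ℤ.neg-distrib-+ (val s e) (net es e)))

net-pos-∉ : ∀ {as : List (Arc n)} {e} → e ∉ as → net (map pos as) e ≡ 0ℤ
net-pos-∉ {as = []} _ = refl
net-pos-∉ {as = a ∷ as} e∉ =
  cong₂ _+ℤ_ (δ-≢ {f = a} λ { refl → e∉ (here refl) }) (net-pos-∉ (λ e∈ → e∉ (there e∈)))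

net-pos-∈ : ∀ {as : List (Arc n)} {e} → Unique as → e ∈ as → net (map pos as) e ≡ 1ℤ
net-pos-∈ {e = e} (a∉ ∷ U) (here refl) =
  cong₂ _+ℤ_ (δ-refl e) (net-pos-∉ λ e∈ → All.lookup a∉ e∈ refl)
net-pos-∈ (a∉ ∷ U) (there e∈) = cong₂ _+ℤ_ (δ-≢ (All.lookup a∉ e∈)) (net-pos-∈ U e∈)

net-neg : ∀ (as : List (Arc n)) e → net (map neg as) e ≡ -ℤ net (map pos as) e
net-neg []       e = refl
net-neg (a ∷ as) e =
  trans (cong (-ℤ δ a e +ℤ_) (net-neg as e)) (sym (ℤ.neg-distrib-+ (δ a e) (net (map pos as) e)))

-- Replacement of arcs and the closed walks of swaps

infix 4 _∈ᴬ?_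

_∈ᴬ?_ : ∀ (e : Arc n) as → Dec (e ∈ as)
e ∈ᴬ? as = Any.any? (e ≟ᴬ_) as

-- Removed arcs count 1 and added arcs count -1. No arc is both, since the old ones are present in
-- `G` and the new ones absent.
replace-represents : ∀ {old new} → Unique old → Unique new → Replace old new G H →
  Represents (map pos old ++ map neg new) G H
replace-represents {G = G} {H} {old} {new} U V R .net-≡ e =
  trans (net-++ (map pos old) e) (trans (cong (net (map pos old) e +ℤ_) (net-neg new e)) main)
  where
  open Replace R
  module R e = Equivalence (result e)
  main : net (map pos old) e -ℤ net (map pos new) e ≡ χ G e -ℤ χ H e
  main with e ∈ᴬ? old | e ∈ᴬ? new
  ... | yes e∈ | yes e∈′ = contradiction (All.lookup old-present e∈) (All.lookup new-absent e∈′)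
  ... | yes e∈ | no e∉′ = cong₂ _-ℤ_
    (trans (net-pos-∈ U e∈) (sym (χ-∈ G (All.lookup old-present e∈))))
    (trans (net-pos-∉ e∉′) (sym (χ-∉ H λ eH → absurd (R.to e eH))))
    where
    absurd : ¬ (e ∈ new ⊎ (e ∈E G × e ∉ old))
    absurd (inj₁ e∈′)       = e∉′ e∈′
    absurd (inj₂ (_ , e∉)) = e∉ e∈
  ... | no e∉ | yes e∈′ = cong₂ _-ℤ_
    (trans (net-pos-∉ e∉) (sym (χ-∉ G (All.lookup new-absent e∈′))))
    (trans (net-pos-∈ V e∈′) (sym (χ-∈ H (R.from e (inj₁ e∈′)))))
  ... | no e∉ | no e∉′ = trans (cong₂ _-ℤ_ (net-pos-∉ e∉) (net-pos-∉ e∉′))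
    (sym (ℤ.i≡j⇒i-j≡0 {χ G e} {χ H e} (χ-cong G H (mk⇔
      (λ eG → R.from e (inj₂ (eG , e∉)))
      (λ eH → keep (R.to e eH))))))
    where
    keep : e ∈ new ⊎ (e ∈E G × e ∉ old) → e ∈E G
    keep (inj₁ e∈′)      = contradiction e∈′ e∉′
    keep (inj₂ (eG , _)) = eG

replacement : (G : Digraph n) (old new : List (Arc n)) → All Chord new → Digraph n
replacement G old new chords .adj x y =
  does ((x , y) ∈ᴬ? new) ∨ (adj G x y ∧ not (does ((x , y) ∈ᴬ? old)))
replacement G old new chords .loopless x with (x , x) ∈ᴬ? new
... | yes x∈ = contradiction refl (All.lookup chords x∈)
... | no  _  rewrite loopless G x = refl

replacement-replace : ∀ {old new} (chords : All Chord new) →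
  All (_∈E G) old → All (_∉E G) new → Replace old new G (replacement G old new chords)
replacement-replace chords present absent .Replace.old-present = present
replacement-replace chords present absent .Replace.new-absent  = absent
replacement-replace {G = G} {old} {new} chords present absent .Replace.result (x , y)
  with (x , y) ∈ᴬ? new | (x , y) ∈ᴬ? old
... | yes e∈ | _     = mk⇔ (λ _ → inj₁ e∈) (λ _ → refl)
... | no e∉ | yes e∈ =
  mk⇔ (λ eq → contradiction (trans (sym eq) (∧-zeroʳ (adj G x y))) λ ())
      (λ { (inj₁ e∈′) → contradiction e∈′ e∉ ; (inj₂ (_ , e∉′)) → contradiction e∈ e∉′ })
... | no e∉ | no e∉′ =
  mk⇔ (λ eq → inj₂ (trans (sym (∧-identityʳ (adj G x y))) eq , e∉′))
      (λ { (inj₁ e∈′) → contradiction e∈′ e∉ ; (inj₂ (eq , _)) → trans (∧-identityʳ (adj G x y)) eq })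

-- The 4-cycle u_x, w_y, u_z, w_t, with the removed arcs red and the added arcs blue.
rectangle : (x z y t : Fin n) → List (Dart n)
rectangle x z y t = pos (x , y) ∷ neg (z , y) ∷ pos (z , t) ∷ neg (x , t) ∷ []

rectangle-represents : ∀ {x z y t} → x ≢ z →
  Replace ((x , y) ∷ (z , t) ∷ []) ((x , t) ∷ (z , y) ∷ []) G H →
  Represents (rectangle x z y t) G H
rectangle-represents x≢z R = represents-↭
  (↭-prep _ (↭-trans (↭-prep _ (↭-swap _ _ ↭-refl)) (↭-swap _ _ ↭-refl)))
  (replace-represents (((λ { refl → x≢z refl }) ∷ []) ∷ [] ∷ [])
                      (((λ { refl → x≢z refl }) ∷ []) ∷ [] ∷ []) R)

-- The 6-cycle u_x, w_y, u_z, w_x, u_y, w_z, whose opposite nodes are the two copies of one vertex.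
hexagon : (x y z : Fin n) → List (Dart n)
hexagon x y z =
  pos (x , y) ∷ neg (z , y) ∷ pos (z , x) ∷ neg (y , x) ∷ pos (y , z) ∷ neg (x , z) ∷ []

hexagon-represents : ∀ {x y z} → x ≢ y → y ≢ z → z ≢ x →
  Replace ((x , y) ∷ (y , z) ∷ (z , x) ∷ []) ((y , x) ∷ (z , y) ∷ (x , z) ∷ []) G H →
  Represents (hexagon x y z) G H
hexagon-represents {x = x} {y} {z} x≢y y≢z z≢x R = represents-↭
  (↭-prep _ perm)
  (replace-represents
    (((λ { refl → x≢y refl }) ∷ (λ { refl → z≢x refl }) ∷ []) ∷ ((λ { refl → y≢z refl }) ∷ []) ∷ [] ∷ [])
    (((λ { refl → y≢z refl }) ∷ (λ { refl → x≢y refl }) ∷ []) ∷ ((λ { refl → z≢x refl }) ∷ []) ∷ [] ∷ []) R)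
  where
  perm : pos (y , z) ∷ pos (z , x) ∷ neg (y , x) ∷ neg (z , y) ∷ neg (x , z) ∷ [] ↭
         neg (z , y) ∷ pos (z , x) ∷ neg (y , x) ∷ pos (y , z) ∷ neg (x , z) ∷ []
  perm = ↭-trans
    (shift (neg (z , y)) (pos (y , z) ∷ pos (z , x) ∷ neg (y , x) ∷ []) (neg (x , z) ∷ []))
    (↭-prep _ (↭-trans (↭-swap _ _ ↭-refl) (↭-prep _ (↭-swap _ _ ↭-refl))))

-- H′ − (number of circuits) is at most m for some multiset of darts representing the difference of
-- G and K, in which an arc may still occur in both colours.
record Cost (G K : Digraph n) (m : ℕ) : Set where
  constructor mkCost
  field
    {darts}    : List (Dart n)
    {circuits} : ℕ
    decomp     : Decomp darts circuits
    represents : Represents darts G K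
    bound      : length darts ≤ 2 * (m + circuits)

-- A single circuit meets the bound with equality: 4 = 2(1 + 1) darts at weight 1, 6 = 2(2 + 1)
-- darts at weight 2.
swap-cost : Swap G H m → Cost G H m
swap-cost (C₄ x≢z _ _ R) = mkCost
  (add (close (refl ∷ refl ∷ refl ∷ [])) [] ↭-refl) (rectangle-represents x≢z R) ℕ.≤-refl
swap-cost (triangular-C₆ x≢y y≢z z≢x R) = mkCost
  (add (close (refl ∷ refl ∷ refl ∷ refl ∷ refl ∷ [])) [] ↭-refl)
  (hexagon-represents x≢y y≢z z≢x R) ℕ.≤-refl

cost-trans : ∀ {i j} → Cost G H i → Cost H K j → Cost G K (i + j)
cost-trans {i = i} {j} (mkCost {es} {k} D r b) (mkCost {fs} {l} E q c) = mkCost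
  (decomp-++ D E) (represents-++ {es = es} r q)
  (ℕ.≤-trans (ℕ.≤-reflexive (List.length-++ es))
    (ℕ.≤-trans (ℕ.+-mono-≤ b c) (ℕ.≤-reflexive (lemma i j k l))))
  where
  lemma : ∀ i j k l → 2 * (i + k) + 2 * (j + l) ≡ 2 * (i + j + (k + l))
  lemma = ℕ-Ring.solve-∀

sequence-cost : SwapSequence G K m → Cost G K m
sequence-cost {G = G} {K} (done G≈K) = mkCost [] r z≤n
  where
  r : Represents [] G K
  r .net-≡ (x , y) = sym (ℤ.i≡j⇒i-j≡0 (cong (if_then 1ℤ else 0ℤ) (G≈K x y)))
sequence-cost (step S T) = cost-trans (swap-cost S) (sequence-cost T)

-- Cancellation of opposite darts

Reduced : List (Dart n) → Set
Reduced es = ∀ {s} → s ∈ es → rev s ∉ es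

open Cost

double-suc : ∀ m k → 2 * (m + suc k) ≡ 2 + 2 * (m + k)
double-suc = ℕ-Ring.solve-∀

-- Each cancellation removes two darts and at most one circuit, so the left side of the bound drops
-- by 2 and the right side by at most 2.
reduce : (C : Cost G K m) → Σ[ C′ ∈ Cost G K m ] Reduced (C′ .darts)
reduce {G = G} {K} {m} C = go (length (C .darts)) C ℕ.≤-refl
  where
  go : ∀ N (C : Cost G K m) → length (C .darts) ≤ N → Σ[ C′ ∈ Cost G K m ] Reduced (C′ .darts)
  go N C@(mkCost {es} D r b) le with Any.any? (λ s → Any.any? (rev s ≟ᴰ_) es) es
  ... | no ¬∃ = C , λ s∈ s̄∈ → ¬∃ (Any.map (λ { refl → s̄∈ }) s∈)
  ... | yes ∃s with s , s∈ , s̄∈ ← find ∃s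
    with fs , j , D′ , σ , k≤ ← cancel s∈ s̄∈ D
    -- `N` bounds the number of darts and makes the recursion structural; it is at least 2 because
    -- `s` and its reverse are present.
    with N | ℕ.≤-trans (ℕ.≤-reflexive (sym (↭-length σ))) le
  ... | suc (suc N) | s≤s (s≤s le′) =
    go (suc N) (mkCost D′ (represents-cancel-pair {s = s} (represents-↭ σ r)) le″) (ℕ.m≤n⇒m≤1+n le′)
    where
    le″ : length fs ≤ 2 * (m + j)
    le″ = ℕ.+-cancelˡ-≤ 2 _ _ (ℕ.≤-trans (ℕ.≤-reflexive (sym (↭-length σ)))
      (ℕ.≤-trans b (ℕ.≤-trans (ℕ.*-monoʳ-≤ 2 (ℕ.+-monoʳ-≤ m k≤)) (ℕ.≤-reflexive (double-suc m j)))))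

-- Reduced systems

count : Dart n → List (Dart n) → ℕ
count s []       = 0
count s (t ∷ es) = (if does (t ≟ᴰ s) then 1 else 0) + count s es

count-∉ : s ∉ es → count s es ≡ 0
count-∉ {es = []} _ = refl
count-∉ {s = s} {es = t ∷ es} s∉ with t ≟ᴰ s
... | yes refl = contradiction (here refl) s∉
... | no _ = count-∉ (λ s∈ → s∉ (there s∈))

count-∈ : s ∈ es → ∃[ c ] count s es ≡ suc c
count-∈ {s = s} {t ∷ es} s∈ with t ≟ᴰ s | s∈
... | yes _ | _ = _ , refl
... | no t≢s | here refl = contradiction refl t≢s
... | no _ | there s∈′ = count-∈ s∈′

net-count : ∀ es (e : Arc n) → net es e ≡ + count (pos e) es -ℤ + count (neg e) es
net-count []           e = refl
net-count (pos f ∷ es) e with does (f ≟ᴬ e)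
... | true  = trans (cong (1ℤ +ℤ_) (net-count es e)) (lemma 1ℤ (+ count (pos e) es) (+ count (neg e) es))
  where
  lemma : ∀ a b c → a +ℤ (b -ℤ c) ≡ (a +ℤ b) -ℤ c
  lemma = solve-∀
... | false = trans (ℤ.+-identityˡ _) (net-count es e)
net-count (neg f ∷ es) e with does (f ≟ᴬ e)
... | true  = trans (cong (-ℤ 1ℤ +ℤ_) (net-count es e)) (lemma 1ℤ (+ count (pos e) es) (+ count (neg e) es))
  where
  lemma : ∀ a b c → -ℤ a +ℤ (b -ℤ c) ≡ b -ℤ (a +ℤ c)
  lemma = solve-∀
... | false = trans (ℤ.+-identityˡ _) (net-count es e)

module _ {n : ℕ} (G K : Digraph n) where
  open RedBlue G K

  Live : Dart n → Set
  Live (pos e) = Red e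
  Live (neg e) = Blue e

live-≢ : ∀ (G K : Digraph n) {e f} → Live G K (pos e) → Live G K (neg f) → e ≢ f
live-≢ G K (eG , _) (_ , e∉G) refl = e∉G eG

module _ {n : ℕ} {G K : Digraph n} where

  module _ {es : List (Dart n)} (r : Represents es G K) (red : Reduced es) where

    -- The opposite dart is absent, so the net value is the multiplicity up to sign. It is nonzero,
    -- and a difference of two indicators is at most 1 in absolute value.
    reduced-live : s ∈ es → Live G K s × count s es ≡ 1
    reduced-live {pos e@(x , y)} s∈
      with c , eq ← count-∈ s∈
      with net-eq ← trans (sym (trans (net-count es e)
             (cong₂ (λ a b → + a -ℤ + b) eq (count-∉ (red s∈))))) (r .net-≡ e)
      with adj G x y | adj K x y
    ... | true  | false with zero ← c = (refl , λ ()) , eq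
    ... | true  | true  with () ← net-eq
    ... | false | true  with () ← net-eq
    ... | false | false with () ← net-eq
    reduced-live {neg e@(x , y)} s∈
      with c , eq ← count-∈ s∈
      with net-eq ← trans (sym (trans (net-count es e)
             (cong₂ (λ a b → + a -ℤ + b) (count-∉ (red s∈)) eq))) (r .net-≡ e)
      with adj G x y | adj K x y
    ... | false | true  with refl ← net-eq = (refl , λ ()) , eq
    ... | true  | true  with () ← net-eq
    ... | true  | false with () ← net-eq
    ... | false | false with () ← net-eq

    -- Without `s` the net value of its arc would vanish or have the wrong sign.
    live-∈ : Live G K s → s ∈ es
    live-∈ {s} l with Any.any? (s ≟ᴰ_) es
    ... | yes s∈ = s∈
    live-∈ {pos e} (eG , e∉K) | no s∉
      with net-eq ← trans (sym (trans (net-count es e)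
             (cong (λ a → + a -ℤ + count (neg e) es) (count-∉ s∉))))
             (trans (r .net-≡ e) (cong₂ _-ℤ_ (χ-∈ G eG) (χ-∉ K e∉K)))
      with count (neg e) es | net-eq
    ... | zero  | ()
    ... | suc _ | ()
    live-∈ {neg e} (eK , e∉G) | no s∉
      with net-eq ← trans (sym (trans (net-count es e)
             (cong (λ a → + count (pos e) es -ℤ + a) (count-∉ s∉))))
             (trans (r .net-≡ e) (cong₂ _-ℤ_ (χ-∉ G e∉G) (χ-∈ K eK)))
      with count (pos e) es | net-eq
    ... | zero  | ()
    ... | suc _ | ()

-- Closing three consecutive darts by a C₄-swap

∈E⇒chord : ∀ (G : Digraph n) {e} → e ∈E G → Chord e
∈E⇒chord G eG refl with () ← trans (sym eG) (loopless G _)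

-- A swap at the `K` end is found by swapping in `K` and then reading that swap backwards.
replace-sym : ∀ {old new} → Replace old new G H → Replace new old H G
replace-sym {G = G} {H} {old} {new} R = record
  { old-present = All.tabulate λ e∈ → R.from _ (inj₁ e∈)
  ; new-absent  = All.tabulate λ e∈ eH → absent e∈ (R.to _ eH)
  ; result      = λ e → mk⇔ (to e) (from e)
  }
  where
  open Replace R
  module R e = Equivalence (result e)
  absent : ∀ {e} → e ∈ old → ¬ (e ∈ new ⊎ (e ∈E G × e ∉ old))
  absent e∈ (inj₁ e∈′)     = All.lookup new-absent e∈′ (All.lookup old-present e∈)
  absent e∈ (inj₂ (_ , e∉)) = e∉ e∈
  to : ∀ e → e ∈E G → e ∈ old ⊎ (e ∈E H × e ∉ new)
  to e eG with e ∈ᴬ? old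
  ... | yes e∈ = inj₁ e∈
  ... | no e∉  = inj₂ (R.from e (inj₂ (eG , e∉)) , λ e∈′ → All.lookup new-absent e∈′ eG)
  from : ∀ e → e ∈ old ⊎ (e ∈E H × e ∉ new) → e ∈E G
  from e (inj₁ e∈) = All.lookup old-present e∈
  from e (inj₂ (eH , e∉)) with R.to e eH
  ... | inj₁ e∈′     = contradiction e∈′ e∉
  ... | inj₂ (eG , _) = eG

rectangle-swap : ∀ {x z y t : Fin n} → x ≢ z → y ≢ t → x ≢ t → z ≢ y →
  (x , y) ∈E G → (z , t) ∈E G → (x , t) ∉E G → (z , y) ∉E G →
  ∃[ H ] (Swap G H 1 × Swap H G 1 × Represents (rectangle x z y t) G H)
rectangle-swap {G = G} x≢z y≢t x≢t z≢y xy zt xt zy =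
  _ , C₄ x≢z y≢t (x≢y ∷ z≢t ∷ x≢t ∷ z≢y ∷ []) R ,
  C₄ x≢z (λ eq → y≢t (sym eq)) (x≢t ∷ z≢y ∷ x≢y ∷ z≢t ∷ []) (replace-sym R) ,
  rectangle-represents x≢z R
  where
  x≢y = ∈E⇒chord G xy
  z≢t = ∈E⇒chord G zt
  R = replacement-replace {G = G} (x≢t ∷ z≢y ∷ []) (xy ∷ zt ∷ []) (xt ∷ zy ∷ [])

represents-reverse : Represents es G K → Represents (reverse (map rev es)) K G
represents-reverse {es = es} r = represents-↭ (↭-sym (↭-reverse (map rev es))) (represents-rev es r)

-- What closing three consecutive darts up by a chord d leads to: a C₄-swap in G, a C₄-swap in K, or
-- d itself lying in the symmetric difference.
data Closing (G K : Digraph n) (s₀ s₁ s₂ d : Dart n) : Set where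
  inˡ  : Swap G G′ 1 → Represents (s₀ ∷ s₁ ∷ s₂ ∷ rev d ∷ []) G G′ → Closing G K s₀ s₁ s₂ d
  inʳ  : Swap K′ K 1 → Represents (s₀ ∷ s₁ ∷ s₂ ∷ rev d ∷ []) K′ K → Closing G K s₀ s₁ s₂ d
  live : Live G K d → d ≢ s₀ → d ≢ s₁ → d ≢ s₂ → Closing G K s₀ s₁ s₂ d

-- If `(x , t)` is absent from `G`, the rectangle is swapped in `G`; if it is present in `K`, it is
-- swapped in `K`. Otherwise the arc is red. The vertices needed to be distinct are so because no
-- arc is both red and blue.
closing-pos : ∀ {x y z t : Fin n} → Live G K (pos (x , y)) → Live G K (neg (z , y)) →
  Live G K (pos (z , t)) → x ≢ t → Closing G K (pos (x , y)) (neg (z , y)) (pos (z , t)) (pos (x , t))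
closing-pos {G = G} {K} {x} {y} {z} {t} xy@(xyG , xyK) zy@(zyK , zyG) zt@(ztG , ztK) x≢t
  with (x , t) ∈E? G | (x , t) ∈E? K
... | yes xtG | no xtK = live (xtG , xtK)
  (λ { refl → live-≢ G K zt zy refl }) (λ ()) (λ { refl → live-≢ G K xy zy refl })
... | no xtG | _
  with _ , S , _ , r ← rectangle-swap {G = G} {x} {z} {y} {t}
         (λ { refl → live-≢ G K xy zy refl }) (λ { refl → live-≢ G K zt zy refl })
         x≢t (∈E⇒chord K zyK) xyG ztG xtG zyG = inˡ S r
... | _ | yes xtK
  with _ , _ , S , r ← rectangle-swap {G = K} {x} {z} {t} {y}
         (λ { refl → live-≢ G K xy zy refl }) (λ { refl → live-≢ G K zt zy refl })
         (∈E⇒chord G xyG) (∈E⇒chord G ztG) xtK zyK xyK ztK =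
  inʳ S (represents-reverse r)

-- The same with the colours interchanged. The darts now start in W whereas `rectangle` starts in U,
-- whence the cyclic shift.
closing-neg : ∀ {x y z t : Fin n} → Live G K (neg (x , y)) → Live G K (pos (x , t)) →
  Live G K (neg (z , t)) → z ≢ y → Closing G K (neg (x , y)) (pos (x , t)) (neg (z , t)) (neg (z , y))
closing-neg {G = G} {K} {x} {y} {z} {t} xy@(xyK , xyG) xt@(xtG , xtK) zt@(ztK , ztG) z≢y
  with (z , y) ∈E? G | (z , y) ∈E? K
... | no zyG | yes zyK = live (zyK , zyG)
  (λ { refl → live-≢ G K xt zt refl }) (λ ()) (λ { refl → live-≢ G K xt xy refl })
... | yes zyG | _
  with _ , S , _ , r ← rectangle-swap {G = G} {x} {z} {t} {y}
         (λ { refl → live-≢ G K xt zt refl }) (λ { refl → live-≢ G K xt xy refl })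
         (∈E⇒chord K xyK) (∈E⇒chord K ztK) xtG zyG xyG ztG =
  inˡ S (represents-↭ (↭-sym (∷↭∷ʳ _ (pos (x , t) ∷ neg (z , t) ∷ pos (z , y) ∷ []))) r)
... | _ | no zyK
  with _ , _ , S , r ← rectangle-swap {G = K} {x} {z} {y} {t}
         (λ { refl → live-≢ G K xt zt refl }) (λ { refl → live-≢ G K xt xy refl })
         (∈E⇒chord G xtG) z≢y xyK ztK xtK zyK =
  inʳ S (represents-↭ (↭-sym (∷↭∷ʳ _ (pos (x , t) ∷ neg (z , t) ∷ pos (z , y) ∷ [])))
                      (represents-reverse r))

-- From circuits to swaps

-- Used when `fs` is a swap made at the `G` end; `represents-cancelʳ` serves the `K` end.
represents-cancelˡ : ∀ fs → Represents (fs ++ es) G K → Represents fs G H → Represents es H K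
represents-cancelˡ {es = es} {G} {K} {H} fs r q .net-≡ e =
  trans (lemma (net fs e) (net es e)) (trans
    (cong₂ _-ℤ_ (trans (sym (net-++ fs e)) (r .net-≡ e)) (q .net-≡ e))
    (lemma′ (χ G e) (χ K e) (χ H e)))
  where
  lemma : ∀ a b → b ≡ (a +ℤ b) -ℤ a
  lemma = solve-∀
  lemma′ : ∀ g k h → (g -ℤ k) -ℤ (g -ℤ h) ≡ h -ℤ k
  lemma′ = solve-∀

represents-cancelʳ : ∀ fs → Represents (fs ++ es) G K → Represents fs H K → Represents es G H
represents-cancelʳ {es = es} {G} {K} {H} fs r q .net-≡ e =
  trans (lemma (net fs e) (net es e)) (trans
    (cong₂ _-ℤ_ (trans (sym (net-++ fs e)) (r .net-≡ e)) (q .net-≡ e))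
    (lemma′ (χ G e) (χ K e) (χ H e)))
  where
  lemma : ∀ a b → b ≡ (a +ℤ b) -ℤ a
  lemma = solve-∀
  lemma′ : ∀ g k h → (g -ℤ k) -ℤ (h -ℤ k) ≡ g -ℤ h
  lemma′ = solve-∀

-- A circuit has at least two darts, so at most m swaps can be paid for in this way.
spend : ∀ {v m} → Decomp es j → 2 * v + length es ≤ 2 * (m + j) →
  ∃[ m′ ] (m ≡ v + m′ × length es ≤ 2 * (m′ + j))
spend {es = es} {j = j} {v = v} {m} D le with h , eq , j≤h ← decomp-length D
  with m′ , refl ← ℕ.m≤n⇒∃[o]m+o≡n (ℕ.+-cancelʳ-≤ j v m (ℕ.≤-trans (ℕ.+-monoʳ-≤ v j≤h)
         (ℕ.*-cancelˡ-≤ 2 (ℕ.≤-trans (ℕ.≤-reflexive (trans (ℕ.*-distribˡ-+ 2 v h)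
           (cong (_+_ (2 * v)) (sym eq)))) le)))) =
  m′ , refl , ℕ.+-cancelˡ-≤ (2 * v) _ _ (ℕ.≤-trans le (ℕ.≤-reflexive (lemma v m′ j)))
  where
  lemma : ∀ v m j → 2 * (v + m + j) ≡ 2 * v + 2 * (m + j)
  lemma = ℕ-Ring.solve-∀

-- `refined` lowers `m` without a swap, `swapˡ` and `swapʳ` pay for a swap at one end, and `shorter`
-- keeps both `m` and the number of circuits.
data Progress (G K : Digraph n) (es : List (Dart n)) (k m ℓ : ℕ) : Set where
  refined : ∀ {m′} → m′ < m → Cost G K m′ → Progress G K es k m ℓ
  swapˡ   : ∀ {v m′} → m ≡ v + m′ → m′ < m → Swap G G′ v → Cost G′ K m′ → Progress G K es k m ℓ
  swapʳ   : ∀ {v m′} → m ≡ v + m′ → m′ < m → Swap K′ K v → Cost G K′ m′ → Progress G K es k m ℓ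
  shorter : Circuit c → Decomp fs k → es ↭ c ++ fs → length c < ℓ → Progress G K es k m ℓ

-- fs is what the k circuits other than the selected one decompose.
module _ {G K : Digraph n} {es fs : List (Dart n)} {k m : ℕ}
  (r : Represents es G K) (red : Reduced es)
  (le : length es ≤ 2 * (m + suc k)) (D : Decomp fs k) where

  -- One more circuit on the same darts leaves room in the bound to lower `m` by one, which `spend`
  -- with `v` = 1 extracts.
  split : Decomp es (suc (suc k)) → Progress G K es k m ℓ
  split D′ with m′ , refl , le′ ← spend {v = 1} {m} D′
                 (ℕ.≤-trans (ℕ.+-monoʳ-≤ 2 le) (ℕ.≤-reflexive (sym (double-suc m (suc k))))) =
    refined ℕ.≤-refl (mkCost D′ r le′)

  -- The circuit s₀ s₁ s₂ p is shortened to d p.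
  shortcut : tail d ≡ tail s₀ → head d ≡ head s₂ → Closing G K s₀ s₁ s₂ d →
    Walk a (s₀ ∷ s₁ ∷ s₂ ∷ []) b → Walk b p a → es ↭ s₀ ∷ s₁ ∷ s₂ ∷ p ++ fs →
    Progress G K es k m (3 + length p)
  shortcut {d = d} {s₀ = s₀} {s₂ = s₂} {s₁ = s₁} {p = p} td hd C (refl ∷ f ∷ g ∷ []) P σ = go C
    where
    dp : Circuit (d ∷ p)
    dp = close′ (sym td) (sym hd) P

    -- The pair `rev d`, `d` is inserted so that the first four darts form the rectangle of the swap
    -- and the rest contains the circuit `d ∷ p`.
    σ′ : s₀ ∷ s₁ ∷ s₂ ∷ rev d ∷ d ∷ p ++ fs ↭ rev d ∷ d ∷ es
    σ′ = ↭-trans (shifts (s₀ ∷ s₁ ∷ s₂ ∷ []) (rev d ∷ d ∷ [])) (↭-prep _ (↭-prep _ (↭-sym σ)))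

    r′ : Represents (s₀ ∷ s₁ ∷ s₂ ∷ rev d ∷ d ∷ p ++ fs) G K
    r′ = represents-↭ (↭-sym σ′)
      (subst (λ s → Represents (rev d ∷ s ∷ es) G K) (rev-involutive d)
        (represents-insert-pair {s = rev d} r))

    -- Two darts fewer in equally many circuits pay for weight 1.
    cheaper : ∃[ m′ ] (m ≡ 1 + m′ × length (d ∷ p ++ fs) ≤ 2 * (m′ + suc k))
    cheaper = spend {v = 1} (add dp D ↭-refl) (ℕ.≤-trans (ℕ.≤-reflexive (sym (↭-length σ))) le)

    go : Closing G K s₀ s₁ s₂ d → Progress G K es k m (3 + length p)
    go (inˡ S q) with _ , eq , le′ ← cheaper =
      swapˡ eq (ℕ.≤-reflexive (sym eq)) S
        (mkCost (add dp D ↭-refl) (represents-cancelˡ (s₀ ∷ s₁ ∷ s₂ ∷ rev d ∷ []) r′ q) le′)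
    go (inʳ S q) with _ , eq , le′ ← cheaper =
      swapʳ eq (ℕ.≤-reflexive (sym eq)) S
        (mkCost (add dp D ↭-refl) (represents-cancelʳ (s₀ ∷ s₁ ∷ s₂ ∷ rev d ∷ []) r′ q) le′)
    go (live l ≢₀ ≢₁ ≢₂) with ∈-resp-↭ σ (live-∈ r red l)
    ... | here eq = contradiction eq ≢₀
    ... | there (here eq) = contradiction eq ≢₁
    ... | there (there (here eq)) = contradiction eq ≢₂
    ... | there (there (there d∈)) with ∈-++⁻ p d∈
    -- With `d` in the same circuit, `s₀ s₁ s₂ p₁` and `d p₂` close up separately, since `d` and
    -- `s₀ s₁ s₂` have the same ends.
    ... | inj₁ d∈p with p₁ , p₂ , refl ← ∈-∃++ d∈p
      with _ , P₁ , refl ∷ P₂ ← walk-++⁻ p₁ P =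
      split (add (close (f ∷ g ∷ subst (Walk _ p₁) td P₁))
        (add (close′ (sym td) refl P₂) D ↭-refl)
        (↭-trans σ (↭-prep _ (↭-prep _ (↭-prep _ (++-assoc p₁ (d ∷ p₂) fs))))))
    -- With `d` in another circuit `d q`, the two trade: the other becomes `s₀ s₁ s₂ q`, longer by
    -- two, and the selected one `d p`, shorter by two.
    ... | inj₂ d∈fs with q , gs , _ , close Q , E , τ , refl ← focus d∈fs D =
      shorter dp
        (add (close (f ∷ g ∷ subst (λ v → Walk v q (tail s₀)) hd (subst (Walk _ q) td Q))) E ↭-refl)
        (↭-trans σ (↭-trans (++⁺ˡ (s₀ ∷ s₁ ∷ s₂ ∷ p) τ)
          (↭-trans (shift d (s₀ ∷ s₁ ∷ s₂ ∷ p) (q ++ gs))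
            (↭-prep d (shifts (s₀ ∷ s₁ ∷ s₂ ∷ []) p)))))
        (s≤s (s≤s (ℕ.n≤1+n _)))

  all-live : ∀ c → es ↭ c ++ fs → All (Live G K) c
  all-live c σ = All.tabulate λ s∈ → proj₁ (reduced-live r red (∈-resp-↭ (↭-sym σ) (∈-++⁺ˡ s∈)))

  -- The hexagon may be only a part of the selected circuit. Six darts leave and at most one circuit
  -- is lost, which pays for weight 2.
  hexagon-progress : ∀ {x y z} → Walk (u x) p (u x) → es ↭ hexagon x y z ++ p ++ fs →
    Progress G K es k m ℓ
  hexagon-progress {x = x} {y} {z} P σ
    with xy ∷ zy ∷ zx ∷ yx ∷ yz ∷ xz ∷ _ ← all-live (hexagon x y z ++ _)
           (↭-trans σ (↭-sym (++-assoc (hexagon x y z) _ fs)))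
    with j , k≤j , D′ ← addClosed P D
    with m′ , refl , le′ ← spend {v = 2} {m} D′ (ℕ.+-cancelˡ-≤ 2 _ _
           (ℕ.≤-trans (ℕ.≤-reflexive (sym (↭-length σ)))
             (ℕ.≤-trans le (ℕ.≤-trans (ℕ.*-monoʳ-≤ 2 (ℕ.+-monoʳ-≤ m (s≤s k≤j)))
               (ℕ.≤-reflexive (double-suc m j)))))) =
    swapˡ refl (ℕ.m≤n+m _ 1) (triangular-C₆ x≢y y≢z z≢x R)
      (mkCost D′ (represents-cancelˡ (hexagon x y z) (represents-↭ σ r)
                   (hexagon-represents x≢y y≢z z≢x R)) le′)
    where
    x≢y = ∈E⇒chord G (proj₁ xy)
    y≢z = ∈E⇒chord G (proj₁ yz)
    z≢x = ∈E⇒chord G (proj₁ zx)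

    R = replacement-replace {G = G}
          ((λ eq → x≢y (sym eq)) ∷ (λ eq → y≢z (sym eq)) ∷ (λ eq → z≢x (sym eq)) ∷ [])
          (proj₁ xy ∷ proj₁ yz ∷ proj₁ zx ∷ []) (proj₂ yx ∷ proj₂ zy ∷ proj₂ xz ∷ [])

  rotation : ∀ (xs ys : List (Dart n)) → es ↭ xs ++ ys ++ fs → es ↭ (ys ++ xs) ++ fs
  rotation xs ys σ = ↭-trans σ (↭-trans (shifts xs ys) (↭-sym (++-assoc ys xs fs)))

  rotated : ∀ (xs ys : List (Dart n)) →
    Progress G K es k m (length (ys ++ xs)) → Progress G K es k m (length (xs ++ ys))
  rotated xs ys = subst (Progress G K es k m) (List.length-++-comm ys xs)

  shortcut-after : ∀ xs → tail d ≡ tail s₀ → head d ≡ head s₂ → Closing G K s₀ s₁ s₂ d →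
    Walk a (s₀ ∷ s₁ ∷ s₂ ∷ []) b → Walk b (p ++ xs) a → es ↭ xs ++ (s₀ ∷ s₁ ∷ s₂ ∷ p) ++ fs →
    Progress G K es k m (length (xs ++ s₀ ∷ s₁ ∷ s₂ ∷ p))
  shortcut-after {s₀ = s₀} {s₂ = s₂} {s₁ = s₁} {p = p} xs td hd C W P σ =
    rotated xs ys (shortcut td hd C W P (rotation xs ys σ))
    where ys = s₀ ∷ s₁ ∷ s₂ ∷ p

  -- The first three darts are closed up by the non-chord of `a`. If the next three windows of three
  -- darts are closed up by non-chords as well, then `e`, `f`, `g` are `b`, `c`, `a` and the six
  -- darts form a hexagon.
  progress-hexagonal : ∀ {a b c e f g} → Walk (u g) p (u a) →
    es ↭ (pos (a , b) ∷ neg (c , b) ∷ pos (c , a) ∷ neg (e , a) ∷ pos (e , f) ∷ neg (g , f) ∷ p) ++ fs →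
    Progress G K es k m (6 + length p)
  progress-hexagonal {a = a} {b} {c} {e} {f} {g} P σ
    with ab ∷ cb ∷ ca ∷ ea ∷ ef ∷ gf ∷ _ ← all-live _ σ
    with e Fin.≟ b | c Fin.≟ f | g Fin.≟ a
  ... | no e≢b | _ | _ = shortcut-after (pos (a , b) ∷ [])
    refl refl (closing-neg cb ca ea e≢b) (refl ∷ refl ∷ refl ∷ [])
    (refl ∷ refl ∷ walk-++⁺ P (refl ∷ [])) σ
  ... | _ | no c≢f | _ = shortcut-after (pos (a , b) ∷ neg (c , b) ∷ [])
    refl refl (closing-pos ca ea ef c≢f) (refl ∷ refl ∷ refl ∷ [])
    (refl ∷ walk-++⁺ P (refl ∷ refl ∷ [])) σ
  ... | _ | _ | no g≢a = shortcut-after (pos (a , b) ∷ neg (c , b) ∷ pos (c , a) ∷ [])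
    refl refl (closing-neg ea ef gf g≢a) (refl ∷ refl ∷ refl ∷ [])
    (walk-++⁺ P (refl ∷ refl ∷ refl ∷ [])) σ
  ... | yes refl | yes refl | yes refl = hexagon-progress P σ

  progress-square : ∀ {a b c d} → Walk (w d) p (u a) →
    es ↭ (pos (a , b) ∷ neg (c , b) ∷ pos (c , d) ∷ p) ++ fs →
    Progress G K es k m (3 + length p)
  progress-square {a = a} {b} {c} {d} P σ
    with ab ∷ cb ∷ cd ∷ ps ← all-live _ σ
    with a Fin.≟ d
  ... | no a≢d = shortcut refl refl (closing-pos ab cb cd a≢d) (refl ∷ refl ∷ refl ∷ []) P σ
  ... | yes refl with P | ps
  ... | _∷_ {s = pos _} () _ | _
  -- A circuit of four darts would end in a loop of `K`, so there are at least six darts.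
  ... | _∷_ {s = neg _} refl [] | dd ∷ _ = contradiction refl (∈E⇒chord K (proj₁ dd))
  ... | _∷_ {s = neg _} refl (_∷_ {s = neg _} () _) | _
  ... | _∷_ {s = neg _} refl (_∷_ {s = pos _} refl (_∷_ {s = pos _} () _)) | _
  ... | _∷_ {s = neg _} refl (_∷_ {s = pos _} refl (_∷_ {s = neg _} refl Q)) | _ = progress-hexagonal Q σ

  progress-pos : ∀ {a b} → Walk (w b) p (u a) → es ↭ (pos (a , b) ∷ p) ++ fs →
    Progress G K es k m (suc (length p))
  progress-pos (_∷_ {s = pos _} () _) _
  -- A circuit of two darts would use one arc in both colours.
  progress-pos (_∷_ {s = neg _} refl []) σ with ab ∷ ab′ ∷ _ ← all-live _ σ =
    contradiction refl (live-≢ G K ab ab′)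
  progress-pos (_∷_ {s = neg _} refl (_∷_ {s = neg _} () _)) _
  progress-pos (_∷_ {s = neg _} refl (_∷_ {s = pos _} refl P)) σ = progress-square P σ

  progress : Circuit c → es ↭ c ++ fs → Progress G K es k m (length c)
  progress (close {s = pos _} P) σ = progress-pos P σ
  progress (close {s = neg _} (_∷_ {s = neg _} () _)) σ
  -- Rotating by one dart makes the circuit start in U.
  progress (close {s = s@(neg _)} (_∷_ {s = t@(pos _)} {es = p} refl P)) σ =
    rotated (s ∷ []) (t ∷ p) (progress-pos (walk-++⁺ P (refl ∷ [])) (rotation (s ∷ []) (t ∷ p) σ))

-- Assembly of swap sequences

replace-congˡ : ∀ {old new} → G ≈ H → Replace old new G K → Replace old new H K
replace-congˡ {G = G} {H} {K} {old} {new} eq R = record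
  { old-present = All.map (λ {e} → to {e}) old-present
  ; new-absent  = All.map (λ {e} e∉ eH → e∉ (from {e} eH)) new-absent
  ; result      = λ e → mk⇔
      (λ eK → [ inj₁ , (λ (eG , e∉) → inj₂ (to {e} eG , e∉)) ]′ (Equivalence.to (result e) eK))
      [ (λ e∈ → Equivalence.from (result e) (inj₁ e∈)) ,
        (λ (eH , e∉) → Equivalence.from (result e) (inj₂ (from {e} eH , e∉))) ]′
  }
  where
  open Replace R
  to : ∀ {e} → e ∈E G → e ∈E H
  to eG = trans (sym (eq _ _)) eG
  from : ∀ {e} → e ∈E H → e ∈E G
  from eH = trans (eq _ _) eH

swap-congˡ : G ≈ H → Swap G K m → Swap H K m
swap-congˡ eq (C₄ x≢z y≢t chords R) = C₄ x≢z y≢t chords (replace-congˡ eq R)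
swap-congˡ eq (triangular-C₆ x≢y y≢z z≢x R) = triangular-C₆ x≢y y≢z z≢x (replace-congˡ eq R)

sequence-congˡ : G ≈ H → SwapSequence G K m → SwapSequence H K m
sequence-congˡ eq (done G≈K) = done λ x y → trans (sym (eq x y)) (G≈K x y)
sequence-congˡ eq (step S T) = step (swap-congˡ eq S) T

-- Swaps at the `K` end come last. A sequence reaches its target only up to `≈`, hence the transport
-- of `T`.
sequence-snoc : ∀ {v} → SwapSequence G H m → Swap H K v → SwapSequence G K (m + v)
sequence-snoc {v = v} (done G≈H) T = subst (SwapSequence _ _) (ℕ.+-identityʳ v)
  (step (swap-congˡ (λ x y → sym (G≈H x y)) T) (done λ _ _ → refl))
sequence-snoc {v = v} (step {v = i} {w = j} S S′) T =
  subst (SwapSequence _ _) (sym (ℕ.+-assoc i j v)) (step S (sequence-snoc S′ T))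

represents-[] : Represents [] G K → G ≈ K
represents-[] {G = G} {K} r x y with adj G x y | adj K x y | r .net-≡ (x , y)
... | true  | true  | _ = refl
... | false | false | _ = refl

-- Either the cost m drops, or it stays the same and the selected circuit gets shorter; N and ℓ bound
-- the two.
cost⇒sequence : ∀ N → m < N → Cost G K m → ∃[ l ] (l ≤ m × SwapSequence G K l)
descend : ∀ N ℓ → m < suc N → Represents es G K → Reduced es → length es ≤ 2 * (m + suc k) →
  Decomp fs k → Circuit c → es ↭ c ++ fs → length c < ℓ → ∃[ l ] (l ≤ m × SwapSequence G K l)

cost⇒sequence (suc N) m<N C with reduce C
... | mkCost [] r _ , _ = 0 , z≤n , done (represents-[] r)
... | mkCost (add c D σ) r le , red = descend N _ m<N r red le D c σ ℕ.≤-refl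

descend N (suc ℓ) m<N r red le D c σ (s≤s l<) with progress r red le D c σ
... | refined m′<m C with l , l≤ , S ← cost⇒sequence N (ℕ.<-≤-trans m′<m (ℕ.≤-pred m<N)) C =
  l , ℕ.≤-trans l≤ (ℕ.<⇒≤ m′<m) , S
... | swapˡ refl m′<m T C with l , l≤ , S ← cost⇒sequence N (ℕ.<-≤-trans m′<m (ℕ.≤-pred m<N)) C =
  _ , ℕ.+-monoʳ-≤ _ l≤ , step T S
... | swapʳ {v = v} {m′} refl m′<m T C
  with l , l≤ , S ← cost⇒sequence N (ℕ.<-≤-trans m′<m (ℕ.≤-pred m<N)) C =
  _ , ℕ.≤-trans (ℕ.+-monoˡ-≤ v l≤) (ℕ.≤-reflexive (ℕ.+-comm m′ v)) , sequence-snoc S T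
-- Regrouping leaves the darts `es` as they are, so they stay reduced.
... | shorter c′ D′ σ′ c′< = descend N ℓ m<N r red le D′ c′ σ′ (ℕ.<-≤-trans c′< l<)

-- Existence of decompositions

𝟙 : Bool → ℕ
𝟙 b = if b then 1 else 0

sumOver : List A → (A → ℕ) → ℕ
sumOver xs f = sum (map f xs)

sumOver-cong : ∀ (xs : List A) {f g : A → ℕ} → (∀ x → f x ≡ g x) → sumOver xs f ≡ sumOver xs g
sumOver-cong xs eq = cong sum (List.map-cong eq xs)

sumOver-0 : ∀ (xs : List A) → sumOver xs (λ _ → 0) ≡ 0
sumOver-0 []       = refl
sumOver-0 (_ ∷ xs) = sumOver-0 xs

sumOver-++ : ∀ (xs ys : List A) {f} → sumOver (xs ++ ys) f ≡ sumOver xs f + sumOver ys f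
sumOver-++ xs ys {f} = trans (cong sum (List.map-++ f xs ys)) (sum-++ (map f xs) (map f ys))

sumOver-map : ∀ (g : A → B) xs {f} → sumOver (map g xs) f ≡ sumOver xs (f ∘ g)
sumOver-map g xs = cong sum (sym (List.map-∘ xs))

sumOver-filter : ∀ {P : A → Set} (P? : ∀ x → Dec (P x)) xs {f} →
  sumOver (filter P? xs) f ≡ sumOver xs (λ x → if does (P? x) then f x else 0)
sumOver-filter P? []       = refl
sumOver-filter P? (x ∷ xs) {f} with does (P? x)
... | true  = cong (_+_ (f x)) (sumOver-filter P? xs)
... | false = sumOver-filter P? xs

sumOver-product : ∀ (xs : List A) (ys : List B) {f} →
  sumOver (cartesianProduct xs ys) f ≡ sumOver xs (λ x → sumOver ys (λ y → f (x , y)))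
sumOver-product []       ys     = refl
sumOver-product (x ∷ xs) ys {f} =
  trans (sumOver-++ (map (x ,_) ys) (cartesianProduct xs ys))
    (cong₂ _+_ (sumOver-map (x ,_) ys) (sumOver-product xs ys))

sumOver-select : ∀ (xs : List (Fin n)) x (g : Fin n → ℕ) → Unique xs → x ∈ xs →
  sumOver xs (λ y → if does (y Fin.≟ x) then g y else 0) ≡ g x
sumOver-select (y ∷ xs) x g (y∉ ∷ U) x∈ with y Fin.≟ x | x∈
... | yes refl | _ = trans (cong (_+_ (g x)) (vanish xs y∉)) (ℕ.+-identityʳ (g x))
  where
  vanish : ∀ xs → All (x ≢_) xs → sumOver xs (λ y → if does (y Fin.≟ x) then g y else 0) ≡ 0
  vanish []       []       = refl
  vanish (z ∷ xs) (≢ ∷ ≢s) with z Fin.≟ x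
  ... | yes refl = contradiction refl ≢
  ... | no _     = vanish xs ≢s
... | no y≢x | here refl = contradiction refl y≢x
... | no _ | there x∈′ = sumOver-select xs x g U x∈′

sumOver-allFin : ∀ {n} (f : Fin n → Bool) → sumOver (allFin n) (𝟙 ∘ f) ≡ ∣ Vec.tabulate f ∣
sumOver-allFin {n} f = trans (cong sum (List.map-tabulate id (𝟙 ∘ f))) (go f)
  where
  go : ∀ {m} (f : Fin m → Bool) → sum (tabulate (𝟙 ∘ f)) ≡ ∣ Vec.tabulate f ∣
  go {zero}  f = refl
  go {suc m} f with f Fin.zero
  ... | true  = cong suc (go (f ∘ Fin.suc))
  ... | false = go (f ∘ Fin.suc)

arcs : Digraph n → List (Arc n)
arcs {n} G = filter (_∈E? G) (cartesianProduct (allFin n) (allFin n))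

arcs-unique : (G : Digraph n) → Unique (arcs G)
arcs-unique {n} G = filter⁺ (_∈E? G) (cartesianProduct⁺ (allFin⁺ n) (allFin⁺ n))

net-arcs : ∀ (G : Digraph n) e → net (map pos (arcs G)) e ≡ χ G e
net-arcs G e with e ∈E? G
... | yes eG = trans (net-pos-∈ (arcs-unique G)
  (∈-filter⁺ (_∈E? G) (∈-cartesianProduct⁺ (∈-allFin _) (∈-allFin _)) eG)) (sym (χ-∈ G eG))
... | no e∉G = trans (net-pos-∉ {as = arcs G} λ e∈ → e∉G
  (proj₂ (∈-filter⁻ (_∈E? G) {xs = cartesianProduct (allFin _) (allFin _)} e∈))) (sym (χ-∉ G e∉G))

does-∈E? : ∀ (G : Digraph n) x y → does ((x , y) ∈E? G) ≡ adj G x y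
does-∈E? G x y with adj G x y
... | true  = refl
... | false = refl

sumOver-arcs : ∀ (G : Digraph n) {f} →
  sumOver (arcs G) f ≡
  sumOver (allFin n) (λ x → sumOver (allFin n) (λ y → if adj G x y then f (x , y) else 0))
sumOver-arcs {n} G {f} = trans (sumOver-filter (_∈E? G) (cartesianProduct (allFin n) (allFin n)))
  (trans (sumOver-product (allFin n) (allFin n))
    (sumOver-cong (allFin n) λ x → sumOver-cong (allFin n) λ y →
      cong (if_then f (x , y) else 0) (does-∈E? G x y)))

if-swap : ∀ a b → (if a then 𝟙 b else 0) ≡ (if b then 𝟙 a else 0)
if-swap true  true  = refl
if-swap true  false = refl
if-swap false true  = refl
if-swap false false = refl

sumOver-arcs-out : ∀ (G : Digraph n) x →
  sumOver (arcs G) (λ (x′ , _) → 𝟙 (does (x′ Fin.≟ x))) ≡ outDegree G x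
sumOver-arcs-out {n} G x = begin
  sumOver (arcs G) (λ (x′ , _) → 𝟙 (does (x′ Fin.≟ x)))
    ≡⟨ sumOver-arcs G ⟩
  sumOver (allFin n) (λ x′ → sumOver (allFin n) λ y → if adj G x′ y then 𝟙 (does (x′ Fin.≟ x)) else 0)
    ≡⟨ sumOver-cong (allFin n) (λ x′ → pull x′ (does (x′ Fin.≟ x))) ⟩
  sumOver (allFin n) (λ x′ → if does (x′ Fin.≟ x) then sumOver (allFin n) (λ y → 𝟙 (adj G x′ y)) else 0)
    ≡⟨ sumOver-select (allFin n) x (λ x′ → sumOver (allFin n) λ y → 𝟙 (adj G x′ y))
         (allFin⁺ n) (∈-allFin x) ⟩
  sumOver (allFin n) (λ y → 𝟙 (adj G x y))
    ≡⟨ sumOver-allFin (adj G x) ⟩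
  outDegree G x ∎
  where
  open ≡-Reasoning
  pull : ∀ x′ b → sumOver (allFin n) (λ y → if adj G x′ y then 𝟙 b else 0) ≡
                   (if b then sumOver (allFin n) (λ y → 𝟙 (adj G x′ y)) else 0)
  pull x′ true  = refl
  pull x′ false = trans (sumOver-cong (allFin n) (λ y → if-swap (adj G x′ y) false)) (sumOver-0 (allFin n))

sumOver-arcs-in : ∀ (G : Digraph n) y →
  sumOver (arcs G) (λ (_ , y′) → 𝟙 (does (y′ Fin.≟ y))) ≡ inDegree G y
sumOver-arcs-in {n} G y = begin
  sumOver (arcs G) (λ (_ , y′) → 𝟙 (does (y′ Fin.≟ y)))
    ≡⟨ sumOver-arcs G ⟩
  sumOver (allFin n) (λ x → sumOver (allFin n) λ y′ → if adj G x y′ then 𝟙 (does (y′ Fin.≟ y)) else 0)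
    ≡⟨ sumOver-cong (allFin n) (λ x → trans
         (sumOver-cong (allFin n) (λ y′ → if-swap (adj G x y′) (does (y′ Fin.≟ y))))
         (sumOver-select (allFin n) y (λ y′ → 𝟙 (adj G x y′)) (allFin⁺ n) (∈-allFin y))) ⟩
  sumOver (allFin n) (λ x → 𝟙 (adj G x y))
    ≡⟨ sumOver-allFin (λ x → adj G x y) ⟩
  inDegree G y ∎
  where open ≡-Reasoning

infix 4 _≟ᴺ_

_≟ᴺ_ : DecidableEquality (Node n)
u x ≟ᴺ u y = map′ (cong u) (λ { refl → refl }) (x Fin.≟ y)
u x ≟ᴺ w y = no λ ()
w x ≟ᴺ u y = no λ ()
w x ≟ᴺ w y = map′ (cong w) (λ { refl → refl }) (x Fin.≟ y)

-- Kronecker delta on nodes; summed over darts through `tail` or `head`, it counts those leaving or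
-- entering `v`.
ι : Node n → Node n → ℕ
ι v a = 𝟙 (does (a ≟ᴺ v))

ι-refl : (v : Node n) → ι v v ≡ 1
ι-refl v with v ≟ᴺ v
... | yes _   = refl
... | no v≢v = contradiction refl v≢v

ι-≢ : a ≢ v → ι v a ≡ 0
ι-≢ {a = a} {v} a≢v with a ≟ᴺ v
... | yes a≡v = contradiction a≡v a≢v
... | no _    = refl

ι-positive : ∀ es (f : Dart n → Node n) → sumOver es (ι v ∘ f) ≢ 0 → ∃[ s ] (s ∈ es × f s ≡ v)
ι-positive []       f ne = contradiction refl ne
ι-positive {v = v} (s ∷ es) f ne with f s ≟ᴺ v
... | yes eq = s , here refl , eq
... | no _ with t , t∈ , eq ← ι-positive es f ne = t , there t∈ , eq

-- The darts es complete a walk from a to b to a balanced system.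
BalancedUpTo : Node n → Node n → List (Dart n) → Set
BalancedUpTo a b es = ∀ v → sumOver es (ι v ∘ tail) + ι v a ≡ sumOver es (ι v ∘ head) + ι v b

balancedUpTo-∷ : ∀ (s : Dart n) → es ↭ s ∷ fs → BalancedUpTo a (tail s) es → BalancedUpTo a (head s) fs
balancedUpTo-∷ {es = es} {fs} {a} s σ bal v = ℕ.+-cancelˡ-≡ (ι v (tail s)) _ _ (begin
  ι v (tail s) + (sumOver fs (ι v ∘ tail) + ι v a)
    ≡⟨ ℕ.+-assoc (ι v (tail s)) _ _ ⟨
  sumOver (s ∷ fs) (ι v ∘ tail) + ι v a
    ≡⟨ cong (_+ ι v a) (sum-↭ (map⁺ (ι v ∘ tail) σ)) ⟨
  sumOver es (ι v ∘ tail) + ι v a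
    ≡⟨ bal v ⟩
  sumOver es (ι v ∘ head) + ι v (tail s)
    ≡⟨ cong (_+ ι v (tail s)) (sum-↭ (map⁺ (ι v ∘ head) σ)) ⟩
  sumOver (s ∷ fs) (ι v ∘ head) + ι v (tail s)
    ≡⟨ lemma (ι v (head s)) (sumOver fs (ι v ∘ head)) (ι v (tail s)) ⟩
  ι v (tail s) + (sumOver fs (ι v ∘ head) + ι v (head s)) ∎)
  where
  open ≡-Reasoning
  lemma : ∀ x y z → x + y + z ≡ z + (y + x)
  lemma = ℕ-Ring.solve-∀

Balanced : List (Dart n) → Set
Balanced es = ∀ v → sumOver es (ι v ∘ tail) ≡ sumOver es (ι v ∘ head)

balanced⇒decomp : ∀ N es → length es ≤ N → Balanced {n} es → ∃[ k ] Decomp es k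
extend-walk : ∀ N es → length es ≤ N → Walk a c b → BalancedUpTo a b es → ∃[ k ] Decomp (c ++ es) k

balanced⇒decomp N []       _        _ = 0 , []
balanced⇒decomp (suc N) (s ∷ es) (s≤s le) bal =
  extend-walk N es le (refl ∷ []) λ v →
    trans (ℕ.+-comm _ (ι v (tail s))) (trans (bal v) (ℕ.+-comm (ι v (head s)) _))

extend-walk {a = a} {c = c} {b = b} N es le W bal with a ≟ᴺ b
... | yes refl with k , D ← balanced⇒decomp N es le (λ v → ℕ.+-cancelʳ-≡ _ _ _ (bal v))
  with j , _ , D′ ← addClosed W D = j , D′
... | no a≢b
  with s , s∈ , refl ← ι-positive es tail (λ eq → ℕ.m+1+n≢0 _ (sym (trans
         (sym (cong₂ _+_ eq (ι-≢ a≢b)))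
         (trans (bal b) (cong (_+_ (sumOver es (ι b ∘ head))) (ι-refl b))))))
  with ys , zs , refl ← ∈-∃++ s∈
  with N | ℕ.≤-trans (ℕ.≤-reflexive (sym (↭-length (shift s ys zs)))) le
... | suc N′ | s≤s le′
  with k , D ← extend-walk N′ (ys ++ zs) le′ (walk-++⁺ W (refl ∷ []))
                 (balancedUpTo-∷ {a = a} s (shift s ys zs) bal) =
  k , decomp-↭ (↭-trans (++⁺ˡ c (shift s ys zs)) (↭-sym (++-assoc c (s ∷ []) (ys ++ zs)))) D

-- Common arcs are kept in both colours, which makes the balance a plain degree count.
overlay : Digraph n → Digraph n → List (Dart n)
overlay G K = map pos (arcs G) ++ map neg (arcs K)

overlay-represents : (G K : Digraph n) → Represents (overlay G K) G K
overlay-represents G K .net-≡ e = trans (net-++ (map pos (arcs G)) e)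
  (cong₂ _+ℤ_ (net-arcs G e) (trans (net-neg (arcs K) e) (cong -ℤ_ (net-arcs K e))))

-- At u_x the darts leaving count the out-degree in `G` and those entering the out-degree in `K`; at
-- w_y the in-degrees in `K` and in `G`.
overlay-balanced : ∀ {d⁺ d⁻ : Vector ℕ n} G K → IsRealization d⁺ d⁻ G → IsRealization d⁺ d⁻ K →
  Balanced (overlay G K)
overlay-balanced G K rG rK v = trans (apart (ι v ∘ tail)) (trans (main v) (sym (apart (ι v ∘ head))))
  where
  apart : ∀ f → sumOver (overlay G K) f ≡
                sumOver (arcs G) (f ∘ pos) + sumOver (arcs K) (f ∘ neg)
  apart f = trans (sumOver-++ (map pos (arcs G)) _)
    (cong₂ _+_ (sumOver-map pos (arcs G)) (sumOver-map neg (arcs K)))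
  main : ∀ v → sumOver (arcs G) (ι v ∘ tail ∘ pos) + sumOver (arcs K) (ι v ∘ tail ∘ neg) ≡
               sumOver (arcs G) (ι v ∘ head ∘ pos) + sumOver (arcs K) (ι v ∘ head ∘ neg)
  main (u x) = trans (cong₂ _+_ (trans (sumOver-arcs-out G x) (trans (proj₁ (rG x)) (trans
    (sym (proj₁ (rK x))) (sym (sumOver-arcs-out K x))))) (sumOver-0 (arcs K)))
    (trans (ℕ.+-comm _ 0) (cong (_+ _) (sym (sumOver-0 (arcs G)))))
  main (w y) = trans (cong₂ _+_ (sumOver-0 (arcs G)) (trans (sumOver-arcs-in K y) (trans
    (proj₂ (rK y)) (trans (sym (proj₂ (rG y))) (sym (sumOver-arcs-in G y))))))
    (trans (ℕ.+-comm 0 _) (cong (_+_ _) (sym (sumOver-0 (arcs K)))))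

-- The crude choice of all darts as `m` suffices to obtain some swap sequence, below which a least
-- weight can be sought.
realizations⇒cost : ∀ {d⁺ d⁻ : Vector ℕ n} G K → IsRealization d⁺ d⁻ G → IsRealization d⁺ d⁻ K →
  ∃[ m ] Cost G K m
realizations⇒cost G K rG rK
  with k , D ← balanced⇒decomp _ (overlay G K) ℕ.≤-refl (overlay-balanced G K rG rK) =
  length (overlay G K) , mkCost D (overlay-represents G K) (ℕ.≤-trans (ℕ.m≤m+n _ k) (ℕ.m≤n*m _ 2))

-- Decidability of swap distances

chord? : (e : Arc n) → Dec (Chord e)
chord? (x , y) = ¬? (x Fin.≟ y)

infixr 2 _×?_

-- The second test receives the witness of the first, as chords must be known before a replacement
-- can be built.
_×?_ : ∀ {A B : Set} → Dec A → (A → Dec B) → Dec (A × B)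
yes a ×? f = map′ (a ,_) proj₂ (f a)
no ¬a ×? f = no λ (a , _) → ¬a a

replace-unique : ∀ {H′ : Digraph n} {old new} → Replace old new G H → Replace old new G H′ → H ≈ H′
replace-unique R R′ x y = ⇔→≡ (⇔-sym (result R′ (x , y)) ⇔-∘ result R (x , y))
  where open Replace

module _ {K : Digraph n} {m : ℕ} (seq? : ∀ (H : Digraph n) → Dec (SwapSequence H K m)) (G : Digraph n) where

  -- The result of a replacement is determined up to `≈`, so the quantifier over `H` reduces to one
  -- candidate.
  replace-then? : ∀ old new → All Chord new → Dec (∃[ H ] (Replace old new G H × SwapSequence H K m))
  replace-then? old new chords = map′
    (λ ((present , absent) , S) → _ , replacement-replace chords present absent , S)
    (λ (H , R , S) → (old-present R , new-absent R) , sequence-congˡ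
      (replace-unique R (replacement-replace chords (old-present R) (new-absent R))) S)
    ((All.all? (_∈E? G) old ×-dec All.all? (λ e → ¬? (e ∈E? G)) new)
      ×-dec seq? (replacement G old new chords))
    where open Replace

  C₄-then? : Dec (∃[ H ] (Swap G H 1 × SwapSequence H K m))
  C₄-then? = map′
    (λ (x , y , z , t , (x≢z , y≢t , chords) , H , R , S) → H , C₄ x≢z y≢t chords R , S)
    (λ { (H , C₄ {x} {y} {z} {t} x≢z y≢t chords R , S) →
         x , y , z , t , (x≢z , y≢t , chords) , H , R , S })
    (Fin.any? λ x → Fin.any? λ y → Fin.any? λ z → Fin.any? λ t →
      (¬? (x Fin.≟ z) ×-dec ¬? (y Fin.≟ t) ×-dec All.all? chord? _) ×?
      -- The last two chords are those of the new arcs.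
      λ { (_ , _ , _ ∷ _ ∷ chords) → replace-then? _ _ chords })

  C₆-then? : Dec (∃[ H ] (Swap G H 2 × SwapSequence H K m))
  C₆-then? = map′
    (λ (x , y , z , (x≢y , y≢z , z≢x) , H , R , S) → H , triangular-C₆ x≢y y≢z z≢x R , S)
    (λ { (H , triangular-C₆ {x} {y} {z} x≢y y≢z z≢x R , S) →
         x , y , z , (x≢y , y≢z , z≢x) , H , R , S })
    (Fin.any? λ x → Fin.any? λ y → Fin.any? λ z →
      (¬? (x Fin.≟ y) ×-dec ¬? (y Fin.≟ z) ×-dec ¬? (z Fin.≟ x)) ×?
      λ (x≢y , y≢z , z≢x) → replace-then? _ _
        ((λ eq → x≢y (sym eq)) ∷ (λ eq → y≢z (sym eq)) ∷ (λ eq → z≢x (sym eq)) ∷ []))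

-- An index `v + w` obstructs matching against a given weight; here the first swap is exposed with
-- indices in constructor form.
data Unfolded (G K : Digraph n) : ℕ → Set where
  none : G ≈ K → Unfolded G K 0
  one  : Swap G H 1 → SwapSequence H K m → Unfolded G K (suc m)
  two  : Swap G H 2 → SwapSequence H K m → Unfolded G K (suc (suc m))

unfold : SwapSequence G K m → Unfolded G K m
unfold (done G≈K) = none G≈K
unfold (step S@(C₄ _ _ _ _) T) = one S T
unfold (step S@(triangular-C₆ _ _ _ _) T) = two S T

sequence? : ∀ (G K : Digraph n) m → Dec (SwapSequence G K m)
sequence? G K zero = map′ done (λ S → case-none (unfold S))
  (Fin.all? λ x → Fin.all? λ y → adj G x y ≟ᴮ adj K x y)
  where
  case-none : Unfolded G K 0 → G ≈ K
  case-none (none G≈K) = G≈K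
sequence? G K (suc zero) = map′ (λ (_ , S , T) → step S T) (λ S → case-one (unfold S))
  (C₄-then? (λ H → sequence? H K zero) G)
  where
  case-one : Unfolded G K 1 → ∃[ H ] (Swap G H 1 × SwapSequence H K 0)
  case-one (one S T) = _ , S , T
sequence? G K (suc (suc m)) = map′
  (λ { (inj₁ (_ , S , T)) → step S T ; (inj₂ (_ , S , T)) → step S T })
  (λ S → case-two (unfold S))
  (C₄-then? (λ H → sequence? H K (suc m)) G ⊎-dec C₆-then? (λ H → sequence? H K m) G)
  where
  case-two : Unfolded G K (suc (suc m)) →
    (∃[ H ] (Swap G H 1 × SwapSequence H K (suc m))) ⊎ (∃[ H ] (Swap G H 2 × SwapSequence H K m))
  case-two (one S T) = inj₁ (_ , S , T)
  case-two (two S T) = inj₂ (_ , S , T)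

-- Constructively a least weight needs decidability; the search runs upwards from 0 and is bounded
-- by the known `m`.
minimum : ∀ {P : ℕ → Set} → (∀ m → Dec (P m)) → ∀ m → P m → ∃[ k ] IsMinimum P k
minimum P? m p with P? 0
minimum P? m       p | yes p₀ = 0 , p₀ , λ _ _ → z≤n
minimum P? zero    p | no ¬p₀ = contradiction p ¬p₀
minimum P? (suc m) p | no ¬p₀ with k , pₖ , least ← minimum (λ i → P? (suc i)) m p =
  suc k , pₖ , λ { zero p₀ → contradiction p₀ ¬p₀ ; (suc j) pⱼ → s≤s (least j pⱼ) }

-- Alternating circuits

unique-++⁻ : ∀ (xs : List A) {ys} → Unique (xs ++ ys) → Unique xs × Unique ys
unique-++⁻ []       U        = [] , U
unique-++⁻ (x ∷ xs) (x∉ ∷ U) with V , W ← unique-++⁻ xs U = All.++⁻ˡ xs x∉ ∷ V , W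

unique-↭ : ∀ {xs ys : List A} → xs ↭ ys → Unique xs → Unique ys
unique-↭ σ = Unique-resp-↭ (setoid _) (↭⇒↭ₛ σ)

unique-map : ∀ {B : Set} {f : A → B} {xs} → (∀ {x y} → x ∈ xs → y ∈ xs → f x ≡ f y → x ≡ y) →
  Unique xs → Unique (map f xs)
unique-map inj []       = []
unique-map inj (x∉ ∷ U) =
  All.map⁺ (All.tabulate λ y∈ eq → All.lookup x∉ y∈ (inj (here refl) (there y∈) eq)) ∷
  unique-map (λ x∈ y∈ → inj (there x∈) (there y∈)) U

unique-count : Unique es → s ∈ es → count s es ≡ 1
unique-count {es = t ∷ es} {s} (t∉ ∷ U) s∈ with t ≟ᴰ s | s∈
... | yes refl | _ = cong suc (count-∉ λ t∈ → All.lookup t∉ t∈ refl)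
... | no t≢s | here refl = contradiction refl t≢s
... | no _ | there s∈′ = unique-count U s∈′

count≤1⇒unique : ∀ (es : List (Dart n)) → (∀ {s} → s ∈ es → count s es ≤ 1) → Unique es
count≤1⇒unique []       _  = []
count≤1⇒unique (s ∷ es) le = All.tabulate fresh ∷ count≤1⇒unique es λ {t} t∈ →
  ℕ.≤-trans (ℕ.m≤n+m (count t es) _) (le (there t∈))
  where
  fresh : ∀ {t} → t ∈ es → s ≢ t
  fresh t∈ refl with s ≟ᴰ s | le (here refl) | count-∈ t∈
  ... | yes _ | s≤s c≤0 | _ , eq with () ← trans (sym eq) (ℕ.n≤0⇒n≡0 c≤0)
  ... | no s≢s | _ | _ = s≢s refl

arc-rev : (s : Dart n) → arc (rev s) ≡ arc s
arc-rev (pos _) = refl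
arc-rev (neg _) = refl

map-arc-reverse : (c : List (Dart n)) → map arc (reverse (map rev c)) ↭ map arc c
map-arc-reverse c = ↭-trans (map⁺ arc (↭-reverse (map rev c)))
  (↭-reflexive (trans (sym (List.map-∘ c)) (List.map-cong arc-rev c)))

module _ {n : ℕ} (G K : Digraph n) where
  open RedBlue G K

  Δ : List (Arc n)
  Δ = symmetricDifference G K

  differ? : ∀ (e : Arc n) → Dec (adj G (proj₁ e) (proj₂ e) ≢ adj K (proj₁ e) (proj₂ e))
  differ? (x , y) = ¬? (adj G x y ≟ᴮ adj K x y)

  Δ-unique : Unique Δ
  Δ-unique = filter⁺ differ? (cartesianProduct⁺ (allFin⁺ n) (allFin⁺ n))

  live⇒∈Δ : Live G K s → arc s ∈ Δ
  live⇒∈Δ {s} l = ∈-filter⁺ differ?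
    (∈-cartesianProduct⁺ (∈-allFin _) (∈-allFin _)) (differ s l)
    where
    differ : ∀ s → Live G K s →
      adj G (proj₁ (arc s)) (proj₂ (arc s)) ≢ adj K (proj₁ (arc s)) (proj₂ (arc s))
    differ (pos _) (eG , e∉K) eq = e∉K (trans (sym eq) eG)
    differ (neg _) (eK , e∉G) eq = e∉G (trans eq eK)

  ∈Δ⇒live : ∀ {e} → e ∈ Δ → ∃[ s ] (Live G K s × arc s ≡ e)
  ∈Δ⇒live {e} e∈
    with _ , G≢K ← ∈-filter⁻ differ? {xs = cartesianProduct (allFin n) (allFin n)} e∈
    with e ∈E? G | e ∈E? K
  ... | yes eG | yes eK = contradiction (trans eG (sym eK)) G≢K
  ... | yes eG | no e∉K = pos e , (eG , e∉K) , refl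
  ... | no e∉G | yes eK = neg e , (eK , e∉G) , refl
  ... | no e∉G | no e∉K = contradiction (trans (¬-not e∉G) (sym (¬-not e∉K))) G≢K

  live-arc-injective : ∀ s t → Live G K s → Live G K t → arc s ≡ arc t → s ≡ t
  live-arc-injective (pos e) (pos f) _ _ refl = refl
  live-arc-injective (neg e) (neg f) _ _ refl = refl
  live-arc-injective (pos e) (neg f) l m eq   = contradiction eq (live-≢ G K l m)
  live-arc-injective (neg e) (pos f) l m eq   = contradiction (sym eq) (live-≢ G K m l)

  -- A reduced representation consists of the live darts, each once, so both lists are free of
  -- repetition and have the same elements.
  reduced⇒Δ : Represents es G K → Reduced es → map arc es ↭ Δ
  reduced⇒Δ {es} r red = ∼bag⇒↭ (unique∧set⇒bag
    (unique-map (λ s∈ t∈ → live-arc-injective _ _ (alive s∈) (alive t∈))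
      (count≤1⇒unique es λ s∈ → ℕ.≤-reflexive (proj₂ (reduced-live r red s∈))))
    Δ-unique
    (mk⇔ to from))
    where
    alive : s ∈ es → Live G K s
    alive s∈ = proj₁ (reduced-live r red s∈)
    to : ∀ {e} → e ∈ map arc es → e ∈ Δ
    to e∈ with s , s∈ , refl ← ∈-map⁻ arc e∈ = live⇒∈Δ {s} (alive s∈)
    from : ∀ {e} → e ∈ Δ → e ∈ map arc es
    from e∈ with s , l , refl ← ∈Δ⇒live e∈ = ∈-map⁺ arc (live-∈ r red {s} l)

  -- Each arc of `Δ` carries exactly one live dart, so every live dart occurs once and no other dart
  -- occurs.
  Δ⇒represents : All (Live G K) es → map arc es ↭ Δ → Represents es G K
  Δ⇒represents {es} alive σ .net-≡ e = trans (net-count es e) main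
    where
    unique : Unique es
    unique = map⁻ (unique-↭ (↭-sym σ) Δ-unique)
    mem : Live G K s → s ∈ es
    mem {s} l with t , t∈ , eq ← ∈-map⁻ arc (∈-resp-↭ (↭-sym σ) (live⇒∈Δ {s} l)) =
      subst (_∈ es) (sym (live-arc-injective s t l (All.lookup alive t∈) eq)) t∈
    present : ∀ s → Live G K s → count s es ≡ 1
    present s l = unique-count unique (mem {s} l)
    absent : ∀ s → ¬ Live G K s → count s es ≡ 0
    absent s ¬l = count-∉ λ s∈ → ¬l (All.lookup alive s∈)
    combine : ∀ {p q} → count (pos e) es ≡ p → count (neg e) es ≡ q →
      + count (pos e) es -ℤ + count (neg e) es ≡ + p -ℤ + q
    combine = cong₂ (λ p q → + p -ℤ + q)
    main : + count (pos e) es -ℤ + count (neg e) es ≡ χ G e -ℤ χ K e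
    main with e ∈E? G | e ∈E? K
    ... | yes eG | yes eK = trans
      (combine (absent _ λ (_ , e∉K) → e∉K eK) (absent _ λ (_ , e∉G) → e∉G eG))
      (sym (cong₂ _-ℤ_ (χ-∈ G eG) (χ-∈ K eK)))
    ... | yes eG | no e∉K = trans
      (combine (present _ (eG , e∉K)) (absent _ λ (_ , e∉G) → e∉G eG))
      (sym (cong₂ _-ℤ_ (χ-∈ G eG) (χ-∉ K e∉K)))
    ... | no e∉G | yes eK = trans
      (combine (absent _ λ (_ , e∉K) → e∉K eK) (present _ (eK , e∉G)))
      (sym (cong₂ _-ℤ_ (χ-∉ G e∉G) (χ-∈ K eK)))
    ... | no e∉G | no e∉K = trans
      (combine (absent _ λ (eG , _) → e∉G eG) (absent _ λ (eK , _) → e∉K eK))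
      (sym (cong₂ _-ℤ_ (χ-∉ G e∉G) (χ-∉ K e∉K)))

  toStep : Dart n → Step {n}
  toStep (pos (x , y)) = x ⟶ y
  toStep (neg (x , y)) = y ⟵ x

  fromStep : Step {n} → Dart n
  fromStep (x ⟶ y) = pos (x , y)
  fromStep (x ⟵ y) = neg (y , x)

  arcOf-toStep : ∀ s → arcOf (toStep s) ≡ arc s
  arcOf-toStep (pos _) = refl
  arcOf-toStep (neg _) = refl

  arc-fromStep : ∀ st → arc (fromStep st) ≡ arcOf st
  arc-fromStep (_ ⟶ _) = refl
  arc-fromStep (_ ⟵ _) = refl

  map-arcOf-toStep : ∀ es → map arcOf (map toStep es) ≡ map arc es
  map-arcOf-toStep es = trans (sym (List.map-∘ es)) (List.map-cong arcOf-toStep es)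

  meet⇒alternates : ∀ s t → head s ≡ tail t → Live G K s → Live G K t → Alternates (toStep s) (toStep t)
  meet⇒alternates (pos _) (neg _) refl l m = both-in (inj₁ (l , m))
  meet⇒alternates (neg _) (pos _) refl l m = both-out (inj₂ (l , m))

  -- Taken with `t` equal to `s`, this is the cyclic condition in which the first step is repeated
  -- at the end.
  walk⇒linked : Walk (head s) es (tail t) → Live G K s → All (Live G K) es → Live G K t →
    Linked Alternates (map toStep (s ∷ es) ∷ʳ toStep t)
  walk⇒linked {s} {es = []} {t} P l [] m = meet⇒alternates s t (walk-[] P) l m ∷ [-]
  walk⇒linked {s} {es = s′ ∷ _} (eq ∷ P) l (l′ ∷ ls) m =
    meet⇒alternates s s′ eq l l′ ∷ walk⇒linked {s′} P l′ ls m

  decomp⇒circuits : All (Live G K) es → Unique (map arc es) → Decomp es k →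
    ∃[ cs ] (All IsAlternatingCircuit cs × concatMap (map arcOf) cs ↭ map arc es × length cs ≡ k)
  decomp⇒circuits _ _ [] = [] , [] , ↭-refl , refl
  decomp⇒circuits alive U (add {p = p} {es = fs} (close {s = s} {es = q} P) D σ)
    with V , W ← unique-++⁻ (map arc p) (subst Unique (List.map-++ arc p fs) (unique-↭ (map⁺ arc σ) U))
       | l ∷ ls , ms ← All.++⁻ p (All-resp-↭ σ alive)
    with cs , Cs , τ , refl ← decomp⇒circuits ms W D =
    map toStep p ∷ cs ,
    (walk⇒linked {s} P l ls l , subst Unique (sym (map-arcOf-toStep p)) V) ∷ Cs ,
    ↭-trans (↭-reflexive (cong (_++ concatMap (map arcOf) cs) (map-arcOf-toStep p)))
      (↭-trans (++⁺ˡ (map arc p) τ)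
        (↭-trans (↭-reflexive (sym (List.map-++ arc p fs))) (map⁺ arc (↭-sym σ)))) ,
    refl

  alternates⇒meet : ∀ {st st′} → Alternates st st′ → head (fromStep st) ≡ tail (fromStep st′)
  alternates⇒meet (both-in _)  = refl
  alternates⇒meet (both-out _) = refl

  linked⇒walk : ∀ {st} sts {st′} → Linked Alternates (st ∷ sts ∷ʳ st′) →
    Walk (head (fromStep st)) (map fromStep sts) (tail (fromStep st′))
  linked⇒walk []         (a ∷ _) = subst (Walk _ []) (alternates⇒meet a) []
  linked⇒walk (st ∷ sts) (a ∷ L) = alternates⇒meet a ∷ linked⇒walk sts L

  red-≢-blue : ∀ {e} → Red e → ¬ Blue e
  red-≢-blue l m = live-≢ G K l m refl

  -- A circuit whose forward steps are blue and whose backward steps are red is a walk of darts only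
  -- after reversal.
  alternates-live : ∀ {st st′} → Alternates st st′ → Live G K (fromStep st) → Live G K (fromStep st′)
  alternates-live (both-in  (inj₁ (_ , l))) _ = l
  alternates-live (both-in  (inj₂ (m , _))) l = contradiction m (red-≢-blue l)
  alternates-live (both-out (inj₂ (_ , l))) _ = l
  alternates-live (both-out (inj₁ (l , _))) m = contradiction m (red-≢-blue l)

  alternates-live-rev : ∀ {st st′} → Alternates st st′ →
    Live G K (rev (fromStep st)) → Live G K (rev (fromStep st′))
  alternates-live-rev (both-in  (inj₂ (_ , l))) _ = l
  alternates-live-rev (both-in  (inj₁ (l , _))) m = contradiction m (red-≢-blue l)
  alternates-live-rev (both-out (inj₁ (_ , l))) _ = l
  alternates-live-rev (both-out (inj₂ (m , _))) l = contradiction m (red-≢-blue l)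

  alternates-orient : ∀ {st st′} → Alternates st st′ →
    Live G K (fromStep st) ⊎ Live G K (rev (fromStep st))
  alternates-orient (both-in  (inj₁ (l , _))) = inj₁ l
  alternates-orient (both-in  (inj₂ (m , _))) = inj₂ m
  alternates-orient (both-out (inj₂ (m , _))) = inj₁ m
  alternates-orient (both-out (inj₁ (l , _))) = inj₂ l

  linked-all : ∀ {P : Step {n} → Set} → (∀ {st st′} → Alternates st st′ → P st → P st′) →
    ∀ {st} sts {st′} → Linked Alternates (st ∷ sts ∷ʳ st′) → P st → All P (st ∷ sts)
  linked-all pres []         _       p = p ∷ []
  linked-all pres (st ∷ sts) (a ∷ L) p = p ∷ linked-all pres sts L (pres a p)

  linked-head : ∀ {st : Step {n}} sts {st′} → Linked Alternates (st ∷ sts ∷ʳ st′) →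
    ∃[ st″ ] Alternates st st″
  linked-head []      (a ∷ _) = _ , a
  linked-head (_ ∷ _) (a ∷ _) = _ , a

  map-arc-fromStep : ∀ (sts : List (Step {n})) → map arc (map fromStep sts) ≡ map arcOf sts
  map-arc-fromStep sts = trans (sym (List.map-∘ sts)) (List.map-cong arc-fromStep sts)

  -- The colour of the first step decides whether all darts read off are live or all their reverses
  -- are; in the second case the circuit is traversed backwards.
  alternating⇒circuit : ∀ (sts : List (Step {n})) → IsAlternatingCircuit sts →
    ∃[ c ] (Circuit c × All (Live G K) c × map arc c ↭ map arcOf sts)
  alternating⇒circuit (st ∷ sts) (L , _) with alternates-orient (proj₂ (linked-head sts L))
  ... | inj₁ l = map fromStep (st ∷ sts) , close (linked⇒walk sts L) ,
    All.map⁺ (linked-all (λ {st} {st′} → alternates-live {st} {st′}) sts L l) ,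
    ↭-reflexive (map-arc-fromStep (st ∷ sts))
  ... | inj₂ l = reverse (map rev (map fromStep (st ∷ sts))) , circuit-reverse (close (linked⇒walk sts L)) ,
    All-resp-↭ (↭-sym (↭-reverse (map rev (map fromStep (st ∷ sts)))))
      (All.map⁺ (All.map⁺ (linked-all (λ {st} {st′} → alternates-live-rev {st} {st′}) sts L l))) ,
    ↭-trans (map-arc-reverse (map fromStep (st ∷ sts))) (↭-reflexive (map-arc-fromStep (st ∷ sts)))

  circuits⇒decomp : ∀ {cs} → All IsAlternatingCircuit cs →
    ∃[ es ] (Decomp es (length cs) × All (Live G K) es × map arc es ↭ concatMap (map arcOf) cs)
  circuits⇒decomp []       = [] , [] , [] , ↭-refl
  circuits⇒decomp (_∷_ {x = sts} C Cs)
    with c , C′ , l , σ ← alternating⇒circuit sts C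
       | es , D , ls , τ ← circuits⇒decomp Cs =
    c ++ es , add C′ D ↭-refl , All.++⁺ l ls ,
    ↭-trans (↭-reflexive (List.map-++ arc c es)) (↭-trans (++⁺ʳ (map arc es) σ) (++⁺ˡ (map arcOf sts) τ))

-- With `2 * h` darts in `k` circuits, swaps of total weight at most `h` - `k` suffice, and the
-- least weight cannot exceed this.
minimal-bound : IsDist G K m → Decomp es k → Represents es G K →
  ∃[ h ] (length es ≡ 2 * h × m + k ≤ h)
minimal-bound {m = m} {k = k} (_ , least) D r with h , eq , k≤h ← decomp-length D
  with i , refl ← ℕ.m≤n⇒∃[o]m+o≡n k≤h
  with l , l≤i , S ← cost⇒sequence (suc i) ℕ.≤-refl
         (mkCost D r (ℕ.≤-reflexive (trans eq (cong (2 *_) (ℕ.+-comm k i))))) =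
  k + i , eq , ℕ.≤-trans (ℕ.≤-reflexive (ℕ.+-comm m k)) (ℕ.+-monoʳ-≤ k (ℕ.≤-trans (least l S) l≤i))

-- A swap sequence of least weight gives a reduced decomposition with at most 2(m + k) darts, and
-- `minimal-bound` gives at least as many, so equality holds.
dist+maxC : ∀ {d⁺ d⁻ : Vector ℕ n} (G K : Digraph n) → IsRealization d⁺ d⁻ G → IsRealization d⁺ d⁻ K →
  ∃[ m ] ∃[ k ] (IsDist G K m × IsMaxC G K k × length (symmetricDifference G K) ≡ 2 * (m + k))
dist+maxC G K rG rK
  with _ , C ← realizations⇒cost G K rG rK
  with _ , _ , S ← cost⇒sequence _ ℕ.≤-refl C
  with m , dist@(T , _) ← minimum (sequence? G K) _ S
  with mkCost {es} {k} D r le , red ← reduce (sequence-cost T)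
  with h , eq , m+k≤h ← minimal-bound dist D r
  with refl ← ℕ.≤-antisym m+k≤h (ℕ.*-cancelˡ-≤ 2 (ℕ.≤-trans (ℕ.≤-reflexive (sym eq)) le))
  with cs , Cs , σ , len ← decomp⇒circuits G K
         (All.tabulate λ s∈ → proj₁ (reduced-live r red s∈))
         (unique-↭ (↭-sym (reduced⇒Δ G K r red)) (Δ-unique G K)) D =
  m , k , dist , ((cs , (Cs , ↭-trans σ (reduced⇒Δ G K r red)) , len) , maximal) , |Δ|
  where
  |Δ| : length (symmetricDifference G K) ≡ 2 * (m + k)
  |Δ| = trans (sym (↭-length (reduced⇒Δ G K r red))) (trans (List.length-map arc es) eq)
  maximal : ∀ j → ∃[ cs ] (IsDecomposition G K cs × length cs ≡ j) → j ≤ k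
  maximal _ (cs , (Cs , σ) , refl)
    with fs , E , ls , τ ← circuits⇒decomp G K Cs
    -- Every decomposition lists the same arcs, so `h` is again m + k and `minimal-bound` leaves j ≤
    -- k.
    with h , eq′ , m+j≤h ← minimal-bound dist E (Δ⇒represents G K ls (↭-trans τ σ)) =
    ℕ.+-cancelˡ-≤ m _ _ (ℕ.≤-trans m+j≤h (ℕ.≤-reflexive (ℕ.*-cancelˡ-≡ _ _ 2
      (trans (sym eq′) (trans (sym (List.length-map arc fs)) (trans (↭-length (↭-trans τ σ)) |Δ|))))))

-- The distance formula

-- Unnormalised rationals compare by cross-multiplication, which turns the claim into an integer
-- identity.
half-double : ∀ m k → + (2 * (m + k)) / 2 ≡ + m / 1 +ℚ + k / 1
half-double m k = ℚ.toℚᵘ-injective (begin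
  toℚᵘ (+ (2 * (m + k)) / 2)
    ≈⟨ ℚ.toℚᵘ-fromℚᵘ _ ⟩
  ℚᵘ.mkℚᵘ (+ (2 * (m + k))) 1
    ≈⟨ ℚᵘ.*≡* (trans (cong (_*ℤ + 1) (ℤ.pos-* 2 (m + k))) (lemma (+ m) (+ k))) ⟩
  ℚᵘ.mkℚᵘ (+ m) 0 ℚᵘ.+ ℚᵘ.mkℚᵘ (+ k) 0
    ≈⟨ ℚᵘ.+-cong (ℚ.toℚᵘ-fromℚᵘ (ℚᵘ.mkℚᵘ (+ m) 0)) (ℚ.toℚᵘ-fromℚᵘ (ℚᵘ.mkℚᵘ (+ k) 0)) ⟨
  toℚᵘ (+ m / 1) ℚᵘ.+ toℚᵘ (+ k / 1)
    ≈⟨ ℚ.toℚᵘ-homo-+ (+ m / 1) (+ k / 1) ⟨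
  toℚᵘ (+ m / 1 +ℚ + k / 1) ∎)
  where
  open ℚᵘ.≃-Reasoning
  lemma : ∀ m k → (+ 2 *ℤ (m +ℤ k)) *ℤ + 1 ≡ (m *ℤ + 1 +ℤ k *ℤ + 1) *ℤ + 2
  lemma = solve-∀

half-minus : ∀ {D} m k → D ≡ 2 * (m + k) → + m / 1 ≡ + D / 2 - + k / 1
half-minus m k refl = sym (begin
  + (2 * (m + k)) / 2 - + k / 1    ≡⟨ cong (_- + k / 1) (half-double m k) ⟩
  + m / 1 +ℚ + k / 1 - + k / 1     ≡⟨ ℚ.+-assoc (+ m / 1) (+ k / 1) _ ⟩
  + m / 1 +ℚ (+ k / 1 - + k / 1)   ≡⟨ cong (+ m / 1 +ℚ_) (ℚ.+-inverseʳ (+ k / 1)) ⟩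
  + m / 1 +ℚ + 0 / 1               ≡⟨ ℚ.+-identityʳ (+ m / 1) ⟩
  + m / 1                          ∎)
  where open ≡-Reasoning

theorem5p4 : ∀ {n : ℕ} (d⁺ d⁻ : Vector ℕ n) (G₁ G₂ : Digraph n) →
    IsRealization d⁺ d⁻ G₁ → IsRealization d⁺ d⁻ G₂ →
    ∃[ dist ] ∃[ maxC ] (IsDist G₁ G₂ dist × IsMaxC G₁ G₂ maxC ×
    + dist / 1 ≡ H′ G₁ G₂ - + maxC / 1)
theorem5p4 d⁺ d⁻ G₁ G₂ r₁ r₂ =
  let m , k , dist , maxC , |Δ| = dist+maxC G₁ G₂ r₁ r₂ in
  m , k , dist , maxC , half-minus m k |Δ|
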